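{- Let $n\geq 3$ be an integer and let $p$ be a prime with $p\equiv 1\pmod{n}$. Then $$ p^n\cdot {}_{n+1}F_{n}\bigg[\begin{matrix} 1&1&\ldots&1\\ &\frac{n+1}{n}&\ldots&\frac{n+1}{n}\end{matrix}\bigg | \, 1\bigg]_{p-1}=\sum_{k=0}^{p-1}\left(\frac{p\cdot k!}{\left(\frac{n+1}{n}\right)_k}\right)^n \equiv-\Gamma_p\left(\frac{1}{n}\right)^n\pmod{p^3}. $$
   Context: For $x$ a real or $p$-adic number, $(x)_k=x(x+1)\cdots(x+k-1)$ for $k\geq1$ and $(x)_0=1$. The truncated hypergeometric series is $$ {}_{n+1}F_{n}\bigg[\begin{matrix}x_1&\ldots&x_{n+1}\\ &y_1&\ldots&y_{n}\end{matrix}\bigg|\,z\bigg]_{m}:=\sum_{k=0}^m\frac{(x_1)_k\cdots(x_{n+1})_k}{(y_1)_k\cdots (y_{n})_k}\cdot\frac{z^k}{k!}. $$ $\Gamma_p$ is Morita's $p$-adic Gamma function: for integers $N\geq1$, $\Gamma_p(N)=(-1)^N\prod_{1\leq k<N,\ p\nmid k}k$, $\Gamma_p(0)=1$, extended to $x\in\mathbb Z_p$ by $\Gamma_p(x)=\lim_{N\to x\ p\text{ -adically}}\Gamma_p(N)$. Congruences are in $\mathbb Z_p$ (with $1/n\in\mathbb Z_p$). -}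

module Defs where

open import Data.Nat as ℕ using (ℕ; zero; suc)
open import Data.Integer as ℤ using (ℤ)
open import Data.Integer.Divisibility as ℤD using ()
open import Data.Rational as ℚ using (ℚ; 0ℚ; 1ℚ; ↥_)
open import Data.Rational.Properties as ℚP using ()
open import Data.List using (List; []; _∷_)
open import Data.Nat.Divisibility using (_∣_)
open import Relation.Nullary using (yes; no)
open import Relation.Nullary.Decidable using (⌊_⌋)
open import Data.Bool using (if_then_else_)

-- total reciprocal on ℚ (1/0 := 0; only ever applied to nonzero values here)
inv : ℚ → ℚ
inv q with q ℚP.≟ 0ℚ
... | yes _ = 0ℚ
... | no q≢0 = ℚ.1/_ q {{ℚ.≢-nonZero q≢0}}

infixl 7 _÷'_
_÷'_ : ℚ → ℚ → ℚ
a ÷' b = a ℚ.* inv b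

powℚ : ℚ → ℕ → ℚ
powℚ x zero = 1ℚ
powℚ x (suc k) = x ℚ.* powℚ x k

powℤ : ℤ → ℕ → ℤ
powℤ x zero = ℤ.1ℤ
powℤ x (suc k) = x ℤ.* powℤ x k

ι : ℕ → ℚ
ι m = ℚ.fromℚᵘ (Data.Rational.Unnormalised.mkℚᵘ (ℤ.+ m) 0)
  where import Data.Rational.Unnormalised

-- rational a/d (d = 0 gives 0, never used)
frac : ℕ → ℕ → ℚ
frac a zero = 0ℚ
frac a (suc d) = ℤ.+ a ℚ./ suc d

poch : ℚ → ℕ → ℚ
poch x zero = 1ℚ
poch x (suc k) = poch x k ℚ.* (x ℚ.+ ι k)

factℚ : ℕ → ℚ
factℚ zero = 1ℚ
factℚ (suc k) = factℚ k ℚ.* ι (suc k)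

prodPoch : List ℚ → ℕ → ℚ
prodPoch [] k = 1ℚ
prodPoch (x ∷ xs) k = poch x k ℚ.* prodPoch xs k

sumTo : ℕ → (ℕ → ℚ) → ℚ
sumTo zero f = f zero
sumTo (suc m) f = sumTo m f ℚ.+ f (suc m)

truncHyp : List ℚ → List ℚ → ℚ → ℕ → ℚ
truncHyp xs ys z m =
  sumTo m (λ k → (prodPoch xs k ÷' prodPoch ys k) ℚ.* (powℚ z k ÷' factℚ k))

-- Morita's p-adic Gamma at integers N ≥ 1 (and Γ_p(0) = 1):
--   Γ_p(N) = (-1)^N ∏_{1 ≤ k < N, p ∤ k} k
prodCoprime : ℕ → ℕ → ℤ
prodCoprime p zero = ℤ.1ℤ
prodCoprime p (suc zero) = ℤ.1ℤ
prodCoprime p (suc (suc j)) =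
  prodCoprime p (suc j) ℤ.* (if ⌊ p Data.Nat.Divisibility.∣? suc j ⌋ then ℤ.1ℤ else ℤ.+ suc j)

Γp-nat : ℕ → ℕ → ℤ
Γp-nat p N = powℤ (ℤ.- ℤ.1ℤ) N ℤ.* prodCoprime p N

-- p-adic congruence of a rational with an integer:  q ≡ z (mod m) in ℤ_p,
-- i.e. m divides the numerator of the reduced fraction q - z.
-- (With m = p^3 this is exactly v_p(q - z) ≥ 3.)
_≡ℚ_[mod_] : ℚ → ℤ → ℕ → Set
q ≡ℚ z [mod m ] = ℤ.+ m ℤD.∣ (↥ (q ℚ.- (z ℚ./ 1)))

replicate : ℕ → ℚ → List ℚ
replicate zero x = []
replicate (suc k) x = x ∷ replicate k x

{-# OPTIONS --safe #-}
module Submission where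

open import Defs
open import Data.Nat as ℕ using (ℕ; zero; suc; z≤n; s≤s)
import Data.Nat.Properties as ℕP
open import Data.Nat.Combinatorics using (_C_; nCk+nC[k+1]≡[n+1]C[k+1]; k>n⇒nCk≡0; nCn≡1)
open import Data.Nat.Divisibility as ℕD using (_∣_; _∣?_; _∣0; divides; >⇒∤)
open import Data.Nat.Primality using (Prime; euclidsLemma; ¬prime[0]; ¬prime[1])
open import Data.Integer as ℤ using (ℤ; +_; 0ℤ; 1ℤ; -1ℤ; ∣_∣)
import Data.Integer.Properties as ℤP
import Data.Integer.Divisibility.Signed as ℤS
open import Data.Integer.Tactic.RingSolver using (solve-∀)
open import Data.Rational as ℚ using (ℚ; 0ℚ; 1ℚ; ↥_; ↧_)
import Data.Rational.Properties as ℚP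
import Data.Rational.Unnormalised as ℚᵘ
import Data.Rational.Unnormalised.Properties as ℚᵘP
open import Data.Bool using (if_then_else_)
open import Data.Empty using (⊥-elim)
open import Data.Maybe using (nothing)
open import Data.Product using (_×_; ∃; _,_; proj₁; proj₂)
open import Data.Sum using (_⊎_; inj₁; inj₂)
open import Function using (_∘_)
open import Level using (0ℓ)
open import Algebra.Bundles using (CommutativeMonoid; CommutativeRing)
open import Relation.Nullary using (¬_; yes; no)
open import Relation.Nullary.Decidable using (⌊_⌋)
open import Relation.Binary.PropositionalEquality using (_≡_; _≢_; refl; sym; trans; cong; cong₂; subst; module ≡-Reasoning)
import Relation.Binary.Reasoning.Setoid as SetoidReasoning
open import Tactic.RingSolver using () renaming (solve-∀ to solveℚ)
open import Tactic.RingSolver.Core.AlmostCommutativeRing using (AlmostCommutativeRing; fromCommutativeRing)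

-- Write r = (p − 1)/n, u = ∏_{j<r} (nj + 1) and q(k) = ∏_{j=1..r} (n(k + j) + 1).  The k-th
-- summand aₖ = p·k!/(1 + 1/n)ₖ equals q(k)/u · ∏_{j≤k} nj/(nj + p), a p-adic integer, and
-- modulo p³
--   ∏_{j≤k} (1 + p/(nj))⁻ⁿ ≡ (−1)ᵏ C(p−1, k) · (1 + ε p² Hₖ),  Hₖ = ∑_{j≤k} 1/j².
-- As q(k)ⁿ is a polynomial in k of degree rn = p − 1, the main term of uⁿ ∑ aₖⁿ is a (p−1)-st
-- finite difference, namely n^{p−1}(p−1)!.  The error term ∑ q(k)ⁿ Hₖ vanishes modulo p:
-- averaging the substitutions k ↦ k + r and k ↦ p − 1 − k replaces Hₖ by ½(H_{k+r} − Hₖ),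
-- and the summand becomes a polynomial of degree p − 3.
-- On the other side, if nN ≡ 1 (mod p³) then N + r = pM with nM ≡ 1 (mod p²).  The functional
-- equation gives n^r Γ_p(pM) ≡ ±u Γ_p(N), while Γ_p(pM) ≡ (−(p−1)!)ᴹ by Wolstenholme's
-- theorem and (−(p−1)!)^{p²} ≡ 1 by Wilson's, so uⁿ Γ_p(N)ⁿ ≡ −n^{p−1}(p−1)!.

-- The formula for aₖ comes from splitting ∏_{j≤k+r} (nj + 1) at k and at r: the factor at j = r is
-- nr + 1 = p, and it cancels the p in the numerator. The weights (-1)ᵏ C(p - 1, k) serve twice.
-- Exactly, they are the coefficients of a (p-1)-st difference, so the main term is evaluated
-- without loss of precision; modulo p they are all 1, so a plain sum over a full period is such a
-- difference too, and it is zero for a polynomial of degree below p - 1. The obstacle is Hₖ. Modulo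
-- p it is a polynomial in k of degree p - 2, so q(k)ⁿ Hₖ has degree well above p - 1. A difference
-- H_{k+r} - Hₖ is instead a sum of r reciprocal squares, and since q(k + r) ≡ n^r (k + 1)⋯(k + r),
-- its poles are absorbed by q(k + r)ⁿ. At a pole a factor must be left to spare, which n ≥ 3
-- provides. Denominators are cleared throughout: relations between integers are multiplied by units
-- modulo p³, which are cancelled at the end.

module Lemmas where

  open import Data.Integer using (-_; _+_; _-_; _*_; _^_)

  -- Products and sums over initial segments of ℕ

  fold< : {A : Set} → (A → A → A) → A → ℕ → (ℕ → A) → A
  fold< _∙_ ε zero    f = ε
  fold< _∙_ ε (suc m) f = fold< _∙_ ε m f ∙ f m

  ∑< ∏< : ℕ → (ℕ → ℤ) → ℤ
  ∑< = fold< _+_ 0ℤ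
  ∏< = fold< _*_ 1ℤ

  -- Stated over a setoid so that one proof serves equality and congruence: `fold` at the monoids of
  -- `modRing m` computes to the same `∑<` and `∏<`.
  module Fold< (M : CommutativeMonoid 0ℓ 0ℓ) where
    open CommutativeMonoid M renaming (refl to ≈-refl; sym to ≈-sym) hiding (trans)
    open SetoidReasoning setoid

    fold : ℕ → (ℕ → Carrier) → Carrier
    fold = fold< _∙_ ε

    fold-cong : ∀ m {f g} → (∀ k → k ℕ.< m → f k ≈ g k) → fold m f ≈ fold m g
    fold-cong zero    h = ≈-refl
    fold-cong (suc m) h = ∙-cong (fold-cong m (λ k k<m → h k (ℕP.m<n⇒m<1+n k<m))) (h m ℕP.≤-refl)

    fold-head : ∀ m f → fold (suc m) f ≈ f 0 ∙ fold m (f ∘ suc)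
    fold-head zero    f = comm _ _
    fold-head (suc m) f = begin
      fold (suc m) f ∙ f (suc m)               ≈⟨ ∙-congʳ (fold-head m f) ⟩
      (f 0 ∙ fold m (f ∘ suc)) ∙ f (suc m)     ≈⟨ assoc _ _ _ ⟩
      f 0 ∙ (fold m (f ∘ suc) ∙ f (suc m))     ∎

    fold-++ : ∀ k m f → fold (k ℕ.+ m) f ≈ fold k f ∙ fold m (f ∘ (k ℕ.+_))
    fold-++ k zero    f rewrite ℕP.+-identityʳ k = ≈-sym (identityʳ _)
    fold-++ k (suc m) f rewrite ℕP.+-suc k m = begin
      fold (k ℕ.+ m) f ∙ f (k ℕ.+ m)                           ≈⟨ ∙-congʳ (fold-++ k m f) ⟩
      (fold k f ∙ fold m (f ∘ (k ℕ.+_))) ∙ f (k ℕ.+ m)         ≈⟨ assoc _ _ _ ⟩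
      fold k f ∙ (fold m (f ∘ (k ℕ.+_)) ∙ f (k ℕ.+ m))         ∎

    fold-∙ : ∀ m f g → fold m (λ k → f k ∙ g k) ≈ fold m f ∙ fold m g
    fold-∙ zero    f g = ≈-sym (identityˡ _)
    fold-∙ (suc m) f g = begin
      fold m (λ k → f k ∙ g k) ∙ (f m ∙ g m)       ≈⟨ ∙-congʳ (fold-∙ m f g) ⟩
      (fold m f ∙ fold m g) ∙ (f m ∙ g m)          ≈⟨ assoc _ _ _ ⟩
      fold m f ∙ (fold m g ∙ (f m ∙ g m))          ≈⟨ ∙-congˡ (≈-sym (assoc _ _ _)) ⟩
      fold m f ∙ ((fold m g ∙ f m) ∙ g m)          ≈⟨ ∙-congˡ (∙-congʳ (comm _ _)) ⟩
      fold m f ∙ ((f m ∙ fold m g) ∙ g m)          ≈⟨ ∙-congˡ (assoc _ _ _) ⟩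
      fold m f ∙ (f m ∙ (fold m g ∙ g m))          ≈⟨ assoc _ _ _ ⟨
      (fold m f ∙ f m) ∙ (fold m g ∙ g m)          ∎

    -- The mirrored index is pinned by an equation, which keeps subtraction out; reversal and
    -- termwise comparison happen in one step.
    fold-reverse : ∀ m {f g} → (∀ k k′ → suc (k ℕ.+ k′) ≡ m → f k ≈ g k′) → fold m f ≈ fold m g
    fold-reverse zero            h = ≈-refl
    fold-reverse (suc m) {f} {g} h = begin
      fold m f ∙ f m           ≈⟨ ∙-cong (fold-reverse m λ k k′ e → h k (suc k′) (cong suc (trans (ℕP.+-suc k k′) e)))
                                         (h m 0 (cong suc (ℕP.+-identityʳ m))) ⟩
      fold m (g ∘ suc) ∙ g 0   ≈⟨ comm _ _ ⟩
      g 0 ∙ fold m (g ∘ suc)   ≈⟨ fold-head m g ⟨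
      fold m g ∙ g m           ∎

  -- Congruences of integers

  infix 4 _≡_[mod_]

  -- An equation with an explicit signed quotient: matching it against `refl` turns each closure
  -- property into a ring identity.
  record _≡_[mod_] (x y m : ℤ) : Set where
    constructor congruent
    field
      quotient : ℤ
      equality : x ≡ y + quotient * m

  module _ {m : ℤ} where

    ≡⇒≡mod : ∀ {x y} → x ≡ y → x ≡ y [mod m ]
    ≡⇒≡mod {x} refl = congruent 0ℤ (sym (ℤP.+-identityʳ x))

    mod-sym : ∀ {x y} → x ≡ y [mod m ] → y ≡ x [mod m ]
    mod-sym {x} {y} (congruent t refl) = congruent (- t) (lemma y t m)
      where
      lemma : ∀ y t m → y ≡ y + t * m + - t * m
      lemma = solve-∀

    mod-trans : ∀ {x y z} → x ≡ y [mod m ] → y ≡ z [mod m ] → x ≡ z [mod m ]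
    mod-trans {z = z} (congruent t refl) (congruent s refl) = congruent (s + t) (lemma z s t m)
      where
      lemma : ∀ z s t m → z + s * m + t * m ≡ z + (s + t) * m
      lemma = solve-∀

    mod-+ : ∀ {x y x′ y′} → x ≡ y [mod m ] → x′ ≡ y′ [mod m ] → x + x′ ≡ y + y′ [mod m ]
    mod-+ {y = y} {y′ = y′} (congruent t refl) (congruent s refl) = congruent (t + s) (lemma y y′ t s m)
      where
      lemma : ∀ y y′ t s m → y + t * m + (y′ + s * m) ≡ y + y′ + (t + s) * m
      lemma = solve-∀

    mod-* : ∀ {x y x′ y′} → x ≡ y [mod m ] → x′ ≡ y′ [mod m ] → x * x′ ≡ y * y′ [mod m ]
    mod-* {y = y} {y′ = y′} (congruent t refl) (congruent s refl) =
      congruent (t * y′ + y * s + t * s * m) (lemma y y′ t s m)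
      where
      lemma : ∀ y y′ t s m → (y + t * m) * (y′ + s * m) ≡ y * y′ + (t * y′ + y * s + t * s * m) * m
      lemma = solve-∀

    mod-neg : ∀ {x y} → x ≡ y [mod m ] → - x ≡ - y [mod m ]
    mod-neg {y = y} (congruent t refl) = congruent (- t) (lemma y t m)
      where
      lemma : ∀ y t m → - (y + t * m) ≡ - y + - t * m
      lemma = solve-∀

    mod-*ˡ : ∀ c {x y} → x ≡ y [mod m ] → c * x ≡ c * y [mod m ]
    mod-*ˡ c = mod-* (≡⇒≡mod (refl {x = c}))

    mod-*ʳ : ∀ c {x y} → x ≡ y [mod m ] → x * c ≡ y * c [mod m ]
    mod-*ʳ c h = mod-* h (≡⇒≡mod (refl {x = c}))

    mod-+ˡ : ∀ c {x y} → x ≡ y [mod m ] → c + x ≡ c + y [mod m ]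
    mod-+ˡ c = mod-+ (≡⇒≡mod (refl {x = c}))

    mod-+ʳ : ∀ c {x y} → x ≡ y [mod m ] → x + c ≡ y + c [mod m ]
    mod-+ʳ c h = mod-+ h (≡⇒≡mod (refl {x = c}))

  modRing : ℤ → CommutativeRing 0ℓ 0ℓ
  modRing m = record
    { Carrier = ℤ ; _≈_ = _≡_[mod m ] ; _+_ = _+_ ; _*_ = _*_ ; -_ = -_ ; 0# = 0ℤ ; 1# = 1ℤ
    ; isCommutativeRing = record
      { isRing = record
        { +-isAbelianGroup = record
          { isGroup = record
            { isMonoid = record
              { isSemigroup = record
                { isMagma = record
                  { isEquivalence = record { refl = ≡⇒≡mod refl ; sym = mod-sym ; trans = mod-trans }
                  ; ∙-cong = mod-+ }
                ; assoc = λ x y z → ≡⇒≡mod (ℤP.+-assoc x y z) }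
              ; identity = (λ x → ≡⇒≡mod (ℤP.+-identityˡ x)) , (λ x → ≡⇒≡mod (ℤP.+-identityʳ x)) }
            ; inverse = (λ x → ≡⇒≡mod (ℤP.+-inverseˡ x)) , (λ x → ≡⇒≡mod (ℤP.+-inverseʳ x))
            ; ⁻¹-cong = mod-neg }
          ; comm = λ x y → ≡⇒≡mod (ℤP.+-comm x y) }
        ; *-cong = mod-*
        ; *-assoc = λ x y z → ≡⇒≡mod (ℤP.*-assoc x y z)
        ; *-identity = (λ x → ≡⇒≡mod (ℤP.*-identityˡ x)) , (λ x → ≡⇒≡mod (ℤP.*-identityʳ x))
        ; distrib = (λ x y z → ≡⇒≡mod (ℤP.*-distribˡ-+ x y z)) , (λ x y z → ≡⇒≡mod (ℤP.*-distribʳ-+ x y z)) }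
      ; *-comm = λ x y → ≡⇒≡mod (ℤP.*-comm x y) } }

  module ∑ = Fold< ℤP.+-0-commutativeMonoid
  module ∏ = Fold< ℤP.*-1-commutativeMonoid
  module ∑mod (m : ℤ) = Fold< (CommutativeRing.+-commutativeMonoid (modRing m))
  module ∏mod (m : ℤ) = Fold< (CommutativeRing.*-commutativeMonoid (modRing m))
  module ModReasoning (m : ℤ) = SetoidReasoning (CommutativeRing.setoid (modRing m))

  ∑-*ˡ : ∀ c m f → c * ∑< m f ≡ ∑< m (λ k → c * f k)
  ∑-*ˡ c zero    f = ℤP.*-zeroʳ c
  ∑-*ˡ c (suc m) f = trans (ℤP.*-distribˡ-+ c _ _) (cong (_+ c * f m) (∑-*ˡ c m f))

  ∏-const : ∀ c m → ∏< m (λ _ → c) ≡ c ^ m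
  ∏-const c zero    = refl
  ∏-const c (suc m) = trans (cong (_* c) (∏-const c m)) (ℤP.*-comm (c ^ m) c)

  *-^ : ∀ x y m → (x * y) ^ m ≡ x ^ m * y ^ m
  *-^ x y zero    = refl
  *-^ x y (suc m) = trans (cong (x * y *_) (*-^ x y m)) (lemma x y (x ^ m) (y ^ m))
    where
    lemma : ∀ x y a b → x * y * (a * b) ≡ x * a * (y * b)
    lemma = solve-∀

  mod-^ : ∀ {m x y} k → x ≡ y [mod m ] → x ^ k ≡ y ^ k [mod m ]
  mod-^ zero    h = ≡⇒≡mod refl
  mod-^ (suc k) h = mod-* h (mod-^ k h)

  mod-≡0-* : ∀ {m x} y → x ≡ 0ℤ [mod m ] → y * x ≡ 0ℤ [mod m ]
  mod-≡0-* {m} y (congruent t refl) = congruent (y * t) (lemma y t m)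
    where
    lemma : ∀ y t m → y * (0ℤ + t * m) ≡ 0ℤ + y * t * m
    lemma = solve-∀

  -- The modulus grows with the factor. With `a = P * P` a congruence modulo p becomes one modulo
  -- p³, which is how error terms carrying p² are handled.
  mod-scale : ∀ {m x y} a → x ≡ y [mod m ] → a * x ≡ a * y [mod a * m ]
  mod-scale {m} {y = y} a (congruent t refl) = congruent t (lemma a y t m)
    where
    lemma : ∀ a y t m → a * (y + t * m) ≡ a * y + t * (a * m)
    lemma = solve-∀

  mod-weaken : ∀ {x y m} a → x ≡ y [mod a * m ] → x ≡ y [mod m ]
  mod-weaken {y = y} {m} a (congruent t refl) = congruent (t * a) (lemma a y t m)
    where
    lemma : ∀ a y t m → y + t * (a * m) ≡ y + t * a * m
    lemma = solve-∀

  record Invertible (m x : ℤ) : Set where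
    constructor invertible
    field
      inverse : ℤ
      *-inverse : x * inverse ≡ 1ℤ [mod m ]

  inv-* : ∀ {m x y} → Invertible m x → Invertible m y → Invertible m (x * y)
  inv-* {x = x} {y} (invertible x′ e) (invertible y′ f) =
    invertible (x′ * y′) (mod-trans (≡⇒≡mod (lemma x y x′ y′)) (mod-* e f))
    where
    lemma : ∀ x y x′ y′ → x * y * (x′ * y′) ≡ x * x′ * (y * y′)
    lemma = solve-∀

  inv-1 : ∀ {m} → Invertible m 1ℤ
  inv-1 = invertible 1ℤ (≡⇒≡mod refl)

  inv-∏ : ∀ {m} k f → (∀ j → j ℕ.< k → Invertible m (f j)) → Invertible m (∏< k f)
  inv-∏ zero    f h = inv-1
  inv-∏ (suc k) f h = inv-* (inv-∏ k f λ j j<k → h j (ℕP.m<n⇒m<1+n j<k)) (h k ℕP.≤-refl)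

  inv-^ : ∀ {m x} k → Invertible m x → Invertible m (x ^ k)
  inv-^ zero    h = inv-1
  inv-^ (suc k) h = inv-* h (inv-^ k h)

  inv-cancel : ∀ {m d x y} → Invertible m d → d * x ≡ d * y [mod m ] → x ≡ y [mod m ]
  inv-cancel {m} {d} {x} {y} (invertible d′ e) h = begin
    x                ≡⟨ ℤP.*-identityˡ x ⟨
    1ℤ * x           ≈⟨ mod-*ʳ x e ⟨
    d * d′ * x       ≡⟨ lemma d d′ x ⟩
    d′ * (d * x)     ≈⟨ mod-*ˡ d′ h ⟩
    d′ * (d * y)     ≡⟨ lemma d d′ y ⟨
    d * d′ * y       ≈⟨ mod-*ʳ y e ⟩
    1ℤ * y           ≡⟨ ℤP.*-identityˡ y ⟩
    y                ∎
    where
    open ModReasoning m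
    lemma : ∀ d d′ x → d * d′ * x ≡ d′ * (d * x)
    lemma = solve-∀

  -- Finite differences

  -- The operator (1 + b·S)ᵐ, where S is the shift k ↦ k + 1; b = −1 gives iterated differences,
  -- while constant functions give powers of 1 + b.
  twist : ℤ → ℕ → (ℕ → ℤ) → ℕ → ℤ
  twist b zero    f k = f k
  twist b (suc m) f k = twist b m f k + b * twist b m f (suc k)

  opaque

    binom : ℕ → ℕ → ℤ
    binom m k = + (m C k)

    binom-pascal : ∀ m k → binom (suc m) (suc k) ≡ binom m k + binom m (suc k)
    binom-pascal m k = trans (cong +_ (sym (nCk+nC[k+1]≡[n+1]C[k+1] m k))) (ℤP.pos-+ (m C k) (m C suc k))

    binom-zero : ∀ m → binom m 0 ≡ 1ℤ
    binom-zero zero    = refl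
    binom-zero (suc m) = refl

    binom-diag : ∀ m → binom m m ≡ 1ℤ
    binom-diag m = cong +_ (nCn≡1 m)

    binom-> : ∀ {m k} → m ℕ.< k → binom m k ≡ 0ℤ
    binom-> m<k = cong +_ (k>n⇒nCk≡0 m<k)

  -- The binomial theorem for 1 + b·S, valid because the shift commutes with scalars.
  twist-∑ : ∀ b m f i → twist b m f i ≡ ∑< (suc m) (λ k → binom m k * b ^ k * f (i ℕ.+ k))
  twist-∑ b zero f i = sym (trans (ℤP.+-identityˡ _)
    (trans (cong (λ c → c * 1ℤ * f (i ℕ.+ 0)) (binom-zero 0)) (trans (ℤP.*-identityˡ _) (cong f (ℕP.+-identityʳ i)))))
  twist-∑ b (suc m) f i = begin
    twist b m f i + b * twist b m f (suc i)
      ≡⟨ cong₂ _+_ (twist-∑ b m f i) (cong (b *_) (twist-∑ b m f (suc i))) ⟩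
    ∑< (suc m) t + b * ∑< (suc m) (λ k → binom m k * b ^ k * f (suc i ℕ.+ k))
      ≡⟨ cong₂ _+_ (sym last) (trans (∑-*ˡ b (suc m) _) (∑.fold-cong (suc m) λ k _ → shift k)) ⟩
    ∑< (suc (suc m)) t + ∑< (suc m) (λ k → binom m k * b ^ suc k * f (i ℕ.+ suc k))
      ≡⟨ cong (_+ ∑< (suc m) (λ k → binom m k * b ^ suc k * f (i ℕ.+ suc k))) (∑.fold-head (suc m) t) ⟩
    t 0 + ∑< (suc m) (t ∘ suc) + ∑< (suc m) (λ k → binom m k * b ^ suc k * f (i ℕ.+ suc k))
      ≡⟨ ℤP.+-assoc (t 0) _ _ ⟩
    t 0 + (∑< (suc m) (t ∘ suc) + ∑< (suc m) (λ k → binom m k * b ^ suc k * f (i ℕ.+ suc k)))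
      ≡⟨ cong₂ _+_ (cong (λ c → c * b ^ 0 * f (i ℕ.+ 0)) (trans (binom-zero m) (sym (binom-zero (suc m)))))
           (trans (sym (∑.fold-∙ (suc m) _ _)) (∑.fold-cong (suc m) λ k _ → pascal k)) ⟩
    t′ 0 + ∑< (suc m) (t′ ∘ suc)
      ≡⟨ ∑.fold-head (suc m) t′ ⟨
    ∑< (suc (suc m)) t′ ∎
    where
    open ≡-Reasoning
    t t′ : ℕ → ℤ
    t  k = binom m k * b ^ k * f (i ℕ.+ k)
    t′ k = binom (suc m) k * b ^ k * f (i ℕ.+ k)
    -- Padding with the vanishing coefficient at m + 1 aligns the two sums, so that Pascal's rule
    -- applies term by term.
    last : ∑< (suc (suc m)) t ≡ ∑< (suc m) t
    last = trans (cong (λ c → ∑< (suc m) t + c * b ^ suc m * f (i ℕ.+ suc m)) (binom-> (ℕP.n<1+n m)))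
                 (ℤP.+-identityʳ _)
    shift : ∀ k → b * (binom m k * b ^ k * f (suc i ℕ.+ k)) ≡ binom m k * b ^ suc k * f (i ℕ.+ suc k)
    shift k rewrite ℕP.+-suc i k = lemma b (binom m k) (b ^ k) (f (suc (i ℕ.+ k)))
      where
      lemma : ∀ b c d e → b * (c * d * e) ≡ c * (b * d) * e
      lemma = solve-∀
    pascal : ∀ k → t (suc k) + binom m k * b ^ suc k * f (i ℕ.+ suc k) ≡ t′ (suc k)
    pascal k rewrite binom-pascal m k = lemma (binom m k) (binom m (suc k)) (b ^ suc k) (f (i ℕ.+ suc k))
      where
      lemma : ∀ c c′ d e → c′ * d * e + c * d * e ≡ (c + c′) * d * e
      lemma = solve-∀

  ∇ : ℕ → (ℕ → ℤ) → ℕ → ℤ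
  ∇ = twist -1ℤ

  twist-cong : ∀ b m {f g} → (∀ k → f k ≡ g k) → ∀ k → twist b m f k ≡ twist b m g k
  twist-cong b zero    h k = h k
  twist-cong b (suc m) h k = cong₂ (λ x y → x + b * y) (twist-cong b m h k) (twist-cong b m h (suc k))

  ∇-+ : ∀ m f g k → ∇ m (λ k → f k + g k) k ≡ ∇ m f k + ∇ m g k
  ∇-+ zero    f g k = refl
  ∇-+ (suc m) f g k rewrite ∇-+ m f g k | ∇-+ m f g (suc k) =
    lemma (∇ m f k) (∇ m g k) (∇ m f (suc k)) (∇ m g (suc k))
    where
    lemma : ∀ a b c d → a + b + -1ℤ * (c + d) ≡ a + -1ℤ * c + (b + -1ℤ * d)
    lemma = solve-∀

  -- The Leibniz rule for differences; those of order two and more vanish on a linear factor, so two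
  -- terms remain.
  ∇-linear-* : ∀ a e m f k → ∇ (suc m) (λ k → (a * + k + e) * f k) k
    ≡ (a * + k + e) * ∇ (suc m) f k - + suc m * a * ∇ m f (suc k)
  ∇-linear-* a e zero f k = lemma a e (+ k) (f k) (f (suc k))
    where
    lemma : ∀ a e k x y → (a * k + e) * x + -1ℤ * ((a * (1ℤ + k) + e) * y)
      ≡ (a * k + e) * (x + -1ℤ * y) - 1ℤ * a * y
    lemma = solve-∀
  ∇-linear-* a e (suc m) f k
    rewrite ∇-linear-* a e m f k | ∇-linear-* a e m f (suc k) =
    lemma a e (+ k) (+ suc m) (∇ m f k) (∇ m f (suc k)) (∇ m f (suc (suc k)))
    where
    lemma : ∀ a e k m x y z →
      (a * k + e) * (x + -1ℤ * y) - m * a * y + -1ℤ * ((a * (1ℤ + k) + e) * (y + -1ℤ * z) - m * a * z)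
      ≡ (a * k + e) * (x + -1ℤ * y + -1ℤ * (y + -1ℤ * z)) - (1ℤ + m) * a * (y + -1ℤ * z)
    lemma = solve-∀

  fact : ℕ → ℤ
  fact m = ∏< m (λ j → + suc j)

  -- f behaves like a polynomial whose coefficient of degree d is c · aᵈ; the sign comes from
  -- ∇ f k = f k − f (k + 1).
  Leading : ℤ → ℕ → ℤ → (ℕ → ℤ) → Set
  Leading a d c f = ∀ k → ∇ d f k ≡ c * (- a) ^ d * fact d

  module _ {a : ℤ} where

    leading-cong : ∀ {d c f g} → (∀ k → f k ≡ g k) → Leading a d c f → Leading a d c g
    leading-cong {d} h l k = trans (sym (twist-cong -1ℤ d h k)) (l k)

    -- In the Leibniz rule the difference of order d + 1 of `f` vanishes, as the one of order d is
    -- constant; only the term with (d + 1)·a survives.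
    leading-linear : ∀ {d c f} e → Leading a d c f → Leading a (suc d) c (λ k → (a * + k + e) * f k)
    leading-linear {d} {c} {f} e l k
      rewrite ∇-linear-* a e d f k | l k | l (suc k) =
      lemma (a * + k + e) a c ((- a) ^ d) (+ suc d) (fact d)
      where
      lemma : ∀ x a c b s g → x * (c * b * g + -1ℤ * (c * b * g)) - s * a * (c * b * g)
        ≡ c * (- a * b) * (g * s)
      lemma = solve-∀

    leading-linear-^ : ∀ {d c f} e j → Leading a d c f → Leading a (j ℕ.+ d) c (λ k → (a * + k + e) ^ j * f k)
    leading-linear-^ {d} {c} {f} e zero l = leading-cong {d} {c} (λ k → sym (ℤP.*-identityˡ (f k))) l
    leading-linear-^ {d} {c} {f} e (suc j) l =
      leading-cong {suc (j ℕ.+ d)} {c} (λ k → sym (ℤP.*-assoc (a * + k + e) ((a * + k + e) ^ j) (f k)))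
        (leading-linear {j ℕ.+ d} {c} e (leading-linear-^ {d} {c} e j l))

    leading-+ : ∀ {d c c′ f g} → Leading a d c f → Leading a d c′ g → Leading a d (c + c′) (λ k → f k + g k)
    leading-+ {d} {c} {c′} {f} {g} l l′ k rewrite ∇-+ d f g k | l k | l′ k =
      lemma c c′ ((- a) ^ d) (fact d)
      where
      lemma : ∀ c c′ b g → c * b * g + c′ * b * g ≡ (c + c′) * b * g
      lemma = solve-∀

    -- A constant has zero difference. This lets a polynomial of too low a degree count as one of
    -- higher degree with coefficient 0.
    leading-raise : ∀ {d c f} → Leading a d c f → Leading a (suc d) 0ℤ f
    leading-raise {d} {c} l k rewrite l k | l (suc k) = lemma (c * (- a) ^ d * fact d)
      where
      lemma : ∀ x → x + -1ℤ * x ≡ 0ℤ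
      lemma = solve-∀

    leading-∏^ : ∀ (e : ℕ → ℤ) j r →
      Leading a (r ℕ.* j) 1ℤ (λ k → ∏< r (λ i → a * + k + e i) ^ j)
    leading-∏^ e j zero k = ℤP.^-zeroˡ j
    leading-∏^ e j (suc r) = leading-cong {j ℕ.+ r ℕ.* j} {1ℤ}
      (λ k → trans (ℤP.*-comm ((a * + k + e r) ^ j) (∏< r (λ i → a * + k + e i) ^ j))
                   (sym (*-^ (∏< r (λ i → a * + k + e i)) (a * + k + e r) j)))
      (leading-linear-^ {r ℕ.* j} {1ℤ} (e r) j (leading-∏^ e j r))

  binom-absorb : ∀ m k → + suc k * binom (suc m) (suc k) ≡ + suc m * binom m k
  binom-absorb zero zero = begin
    1ℤ * binom 1 1  ≡⟨ cong (1ℤ *_) (trans (binom-diag 1) (sym (binom-zero 0))) ⟩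
    1ℤ * binom 0 0  ∎
    where open ≡-Reasoning
  binom-absorb zero (suc k) = begin
    + suc (suc k) * binom 1 (suc (suc k))  ≡⟨ cong (+ suc (suc k) *_) (binom-> {1} (s≤s (s≤s z≤n))) ⟩
    + suc (suc k) * 0ℤ                     ≡⟨ ℤP.*-zeroʳ (+ suc (suc k)) ⟩
    1ℤ * 0ℤ                                ≡⟨ cong (1ℤ *_) (binom-> {0} (s≤s z≤n)) ⟨
    1ℤ * binom 0 (suc k)                   ∎
    where open ≡-Reasoning
  binom-absorb (suc m) zero = begin
    1ℤ * binom (suc (suc m)) 1
      ≡⟨ cong (1ℤ *_) (binom-pascal (suc m) 0) ⟩
    1ℤ * (binom (suc m) 0 + binom (suc m) 1)
      ≡⟨ ℤP.*-distribˡ-+ 1ℤ (binom (suc m) 0) (binom (suc m) 1) ⟩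
    1ℤ * binom (suc m) 0 + 1ℤ * binom (suc m) 1
      ≡⟨ cong (λ x → 1ℤ * binom (suc m) 0 + x) (trans (binom-absorb m 0) (cong (+ suc m *_) (trans (binom-zero m) (sym (binom-zero (suc m)))))) ⟩
    1ℤ * binom (suc m) 0 + + suc m * binom (suc m) 0
      ≡⟨ ℤP.*-distribʳ-+ (binom (suc m) 0) 1ℤ (+ suc m) ⟨
    + suc (suc m) * binom (suc m) 0  ∎
    where open ≡-Reasoning
  binom-absorb (suc m) (suc k) = begin
    + suc (suc k) * binom (suc (suc m)) (suc (suc k))
      ≡⟨ cong (+ suc (suc k) *_) (binom-pascal (suc m) (suc k)) ⟩
    + suc (suc k) * (b + binom (suc m) (suc (suc k)))
      ≡⟨ split (+ suc k) b (binom (suc m) (suc (suc k))) ⟩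
    b + + suc k * b + + suc (suc k) * binom (suc m) (suc (suc k))
      ≡⟨ cong₂ (λ x y → b + x + y) (binom-absorb m k) (binom-absorb m (suc k)) ⟩
    b + + suc m * binom m k + + suc m * binom m (suc k)
      ≡⟨ join (+ suc m) b (binom m k) (binom m (suc k)) ⟩
    b + + suc m * (binom m k + binom m (suc k))
      ≡⟨ cong (λ x → b + + suc m * x) (binom-pascal m k) ⟨
    b + + suc m * b
      ≡⟨ one (+ suc m) b ⟩
    + suc (suc m) * b ∎
    where
    open ≡-Reasoning
    b = binom (suc m) (suc k)
    split : ∀ s b c → (1ℤ + s) * (b + c) ≡ b + s * b + (1ℤ + s) * c
    split = solve-∀
    join : ∀ s b c d → b + s * c + s * d ≡ b + s * (c + d)
    join = solve-∀
    one : ∀ s b → b + s * b ≡ (1ℤ + s) * b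
    one = solve-∀

  alt : ℕ → ℕ → ℤ
  alt m k = binom m k * -1ℤ ^ k

  alt-suc : ∀ m k → + suc k * alt m (suc k) ≡ (+ suc k - + suc m) * alt m k
  alt-suc m k = begin
    + suc k * (binom m (suc k) * (-1ℤ * -1ℤ ^ k))
      ≡⟨ expand (+ suc k) (binom m k) (binom m (suc k)) (-1ℤ ^ k) ⟩
    (+ suc k * binom m k - + suc k * (binom m k + binom m (suc k))) * -1ℤ ^ k
      ≡⟨ cong (λ x → (+ suc k * binom m k - x) * -1ℤ ^ k)
           (trans (cong (+ suc k *_) (sym (binom-pascal m k))) (binom-absorb m k)) ⟩
    (+ suc k * binom m k - + suc m * binom m k) * -1ℤ ^ k
      ≡⟨ factor (+ suc k) (+ suc m) (binom m k) (-1ℤ ^ k) ⟩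
    (+ suc k - + suc m) * (binom m k * -1ℤ ^ k) ∎
    where
    open ≡-Reasoning
    expand : ∀ s b c e → s * (c * (-1ℤ * e)) ≡ (s * b - s * (b + c)) * e
    expand = solve-∀
    factor : ∀ s t b e → (s * b - t * b) * e ≡ (s - t) * (b * e)
    factor = solve-∀

  -- For m = p - 1 the product is ∏ (j - p), a perturbation of k! by multiples of p; this is what
  -- links `alt` to harmonic sums.
  alt-fact : ∀ m k → alt m k * fact k ≡ ∏< k (λ j → + suc j - + suc m)
  alt-fact m zero    = trans (ℤP.*-identityʳ (alt m 0)) (trans (ℤP.*-identityʳ (binom m 0)) (binom-zero m))
  alt-fact m (suc k) = begin
    alt m (suc k) * (fact k * + suc k)              ≡⟨ regroup (alt m (suc k)) (fact k) (+ suc k) ⟩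
    + suc k * alt m (suc k) * fact k                ≡⟨ cong (_* fact k) (alt-suc m k) ⟩
    (+ suc k - + suc m) * alt m k * fact k          ≡⟨ rotate (+ suc k - + suc m) (alt m k) (fact k) ⟩
    alt m k * fact k * (+ suc k - + suc m)          ≡⟨ cong (_* (+ suc k - + suc m)) (alt-fact m k) ⟩
    ∏< (suc k) (λ j → + suc j - + suc m)            ∎
    where
    open ≡-Reasoning
    regroup : ∀ a f s → a * (f * s) ≡ s * a * f
    regroup = solve-∀
    rotate : ∀ s a f → s * a * f ≡ a * f * s
    rotate = solve-∀

  twist-one : ∀ x m k → twist x m (λ _ → 1ℤ) k ≡ (1ℤ + x) ^ m
  twist-one x zero    k = refl
  twist-one x (suc m) k = trans
    (cong₂ (λ a b → a + x * b) (twist-one x m k) (twist-one x m (suc k)))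
    (factor x ((1ℤ + x) ^ m))
    where
    factor : ∀ x a → a + x * a ≡ (1ℤ + x) * a
    factor = solve-∀

  ∑-zero : ∀ {m} k f → (∀ j → j ℕ.< k → f j ≡ 0ℤ [mod m ]) → ∑< k f ≡ 0ℤ [mod m ]
  ∑-zero zero    f h = ≡⇒≡mod refl
  ∑-zero (suc k) f h = mod-+ (∑-zero k f λ j j<k → h j (ℕP.m<n⇒m<1+n j<k)) (h k ℕP.≤-refl)

  self≡0 : ∀ m → m ≡ 0ℤ [mod m ]
  self≡0 m = congruent 1ℤ (lemma m)
    where
    lemma : ∀ m → m ≡ 0ℤ + 1ℤ * m
    lemma = solve-∀

  mod-minus : ∀ {m x y} → x - y ≡ 0ℤ [mod m ] → x ≡ y [mod m ]
  mod-minus {m} {x} {y} h = mod-trans (≡⇒≡mod (lemma x y)) (mod-trans (mod-+ˡ y h) (≡⇒≡mod (ℤP.+-identityʳ y)))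
    where
    lemma : ∀ x y → x ≡ y + (x - y)
    lemma = solve-∀

  minus-mod : ∀ {m x y} → x ≡ y [mod m ] → x - y ≡ 0ℤ [mod m ]
  minus-mod {m} {x} {y} h = mod-trans (mod-+ʳ (- y) h) (≡⇒≡mod (ℤP.+-inverseʳ y))

  ∣⇒≡0 : ∀ {m x} → m ℕD.∣ ∣ x ∣ → x ≡ 0ℤ [mod + m ]
  ∣⇒≡0 {m} {x} d with ℤS.∣ᵤ⇒∣ {+ m} {x} d
  ... | ℤS.divides q eq = congruent q (trans eq (sym (ℤP.+-identityˡ (q * + m))))

  ≡0⇒∣ : ∀ {m x} → x ≡ 0ℤ [mod + m ] → m ℕD.∣ ∣ x ∣
  ≡0⇒∣ {m} {x} (congruent q eq) = ℤS.∣⇒∣ᵤ (ℤS.divides q (trans eq (ℤP.+-identityˡ (q * + m))))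

  -- Congruences modulo a prime

  module Prime-mod (p₁ : ℕ) (prime : Prime (suc p₁)) where
    p : ℕ
    p = suc p₁
    P : ℤ
    P = + p

    euclid : ∀ x y → x * y ≡ 0ℤ [mod P ] → x ≡ 0ℤ [mod P ] ⊎ y ≡ 0ℤ [mod P ]
    euclid x y h with euclidsLemma ∣ x ∣ ∣ y ∣ prime (subst (p ℕD.∣_) (ℤP.abs-* x y) (≡0⇒∣ h))
    ... | inj₁ d = inj₁ (∣⇒≡0 d)
    ... | inj₂ d = inj₂ (∣⇒≡0 d)

    Coprime : ℤ → Set
    Coprime x = ¬ (x ≡ 0ℤ [mod P ])

    coprime-cancel : ∀ {d x y} → Coprime d → d * x ≡ d * y [mod P ] → x ≡ y [mod P ]
    coprime-cancel {d} {x} {y} c h with euclid d (x - y) (mod-trans (≡⇒≡mod (lemma d x y)) (minus-mod h))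
      where
      lemma : ∀ d x y → d * (x - y) ≡ d * x - d * y
      lemma = solve-∀
    ... | inj₁ e = ⊥-elim (c e)
    ... | inj₂ e = mod-minus e

    coprime-* : ∀ {x y} → Coprime x → Coprime y → Coprime (x * y)
    coprime-* {x} {y} cx cy h with euclid x y h
    ... | inj₁ e = cx e
    ... | inj₂ e = cy e

    coprime-mod : ∀ {x y} → x ≡ y [mod P ] → Coprime y → Coprime x
    coprime-mod h c e = c (mod-trans (mod-sym h) e)

    coprime-< : ∀ j → suc j ℕ.< p → Coprime (+ suc j)
    coprime-< j j<p h = >⇒∤ j<p (≡0⇒∣ h)

    binom-prime : ∀ k → k ℕ.< p₁ → binom p (suc k) ≡ 0ℤ [mod P ]
    binom-prime k k<p₁ = coprime-cancel (coprime-< k (s≤s k<p₁)) (begin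
      + suc k * binom p (suc k)  ≡⟨ binom-absorb p₁ k ⟩
      P * binom p₁ k             ≈⟨ mod-*ʳ (binom p₁ k) (self≡0 P) ⟩
      0ℤ                         ≡⟨ ℤP.*-zeroʳ (+ suc k) ⟨
      + suc k * 0ℤ               ∎)
      where open ModReasoning P

    -- The neighbours C(p - 1, k) and C(p - 1, k + 1) add up to C(p, k + 1) ≡ 0, so they differ by a
    -- sign modulo p.
    alt≡1 : ∀ k → k ℕ.< p → alt p₁ k ≡ 1ℤ [mod P ]
    alt≡1 zero    _         = ≡⇒≡mod (trans (ℤP.*-identityʳ (binom p₁ 0)) (binom-zero p₁))
    alt≡1 (suc k) (s≤s k<p) = begin
      binom p₁ (suc k) * (-1ℤ * -1ℤ ^ k)
        ≡⟨ expand (binom p₁ k) (binom p₁ (suc k)) (-1ℤ ^ k) ⟩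
      binom p₁ k * -1ℤ ^ k + (- (-1ℤ ^ k)) * (binom p₁ k + binom p₁ (suc k))
        ≡⟨ cong (λ x → binom p₁ k * -1ℤ ^ k + (- (-1ℤ ^ k)) * x) (binom-pascal p₁ k) ⟨
      binom p₁ k * -1ℤ ^ k + (- (-1ℤ ^ k)) * binom p (suc k)
        ≈⟨ mod-+ (alt≡1 k (ℕP.m<n⇒m<1+n k<p)) (mod-≡0-* (- (-1ℤ ^ k)) (binom-prime k k<p)) ⟩
      1ℤ ∎
      where
      open ModReasoning P
      expand : ∀ b c e → c * (-1ℤ * e) ≡ b * e + (- e) * (b + c)
      expand = solve-∀

    ∑-∇ : ∀ f → ∑< p f ≡ ∇ p₁ f 0 [mod P ]
    ∑-∇ f = mod-trans
      (∑mod.fold-cong P p λ k k<p → mod-trans (≡⇒≡mod (sym (ℤP.*-identityˡ (f k))))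
        (mod-*ʳ (f k) (mod-sym (alt≡1 k k<p))))
      (≡⇒≡mod (sym (twist-∑ -1ℤ p₁ f 0)))

    fermat-suc : ∀ x → (1ℤ + x) ^ p ≡ 1ℤ + x ^ p [mod P ]
    fermat-suc x = begin
      (1ℤ + x) ^ p                 ≡⟨ twist-one x p 0 ⟨
      twist x p (λ _ → 1ℤ) 0       ≡⟨ twist-∑ x p (λ _ → 1ℤ) 0 ⟩
      ∑< p t + t p                 ≡⟨ cong (_+ t p) (∑.fold-head p₁ t) ⟩
      t 0 + ∑< p₁ (t ∘ suc) + t p
        ≈⟨ mod-+ (mod-+ (≡⇒≡mod (cong (λ b → b * 1ℤ * 1ℤ) (binom-zero p)))
             (∑-zero p₁ (t ∘ suc) λ k k<p₁ → mod-trans (≡⇒≡mod (rearrange (binom p (suc k)) (x ^ suc k)))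
                (mod-≡0-* (x ^ suc k) (binom-prime k k<p₁))))
             (≡⇒≡mod (trans (cong (λ b → b * x ^ p * 1ℤ) (binom-diag p)) (unit (x ^ p)))) ⟩
      1ℤ + 0ℤ + x ^ p              ≡⟨⟩
      1ℤ + x ^ p                   ∎
      where
      open ModReasoning P
      t : ℕ → ℤ
      t k = binom p k * x ^ k * 1ℤ
      rearrange : ∀ b y → b * y * 1ℤ ≡ y * b
      rearrange = solve-∀
      unit : ∀ y → 1ℤ * y * 1ℤ ≡ y
      unit = solve-∀

    fermat : ∀ x → (+ x) ^ p ≡ + x [mod P ]
    fermat zero    = ≡⇒≡mod refl
    fermat (suc x) = mod-trans (fermat-suc (+ x)) (mod-+ˡ 1ℤ (fermat x))

    fermat-coprime : ∀ x → Coprime (+ x) → (+ x) ^ p₁ ≡ 1ℤ [mod P ]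
    fermat-coprime x c = coprime-cancel c (mod-trans (fermat x) (≡⇒≡mod (sym (ℤP.*-identityʳ (+ x)))))

  -- Reciprocals modulo p³ and harmonic sums

  ∑-const-1 : ∀ m → ∑< m (λ _ → 1ℤ) ≡ + m
  ∑-const-1 zero    = refl
  ∑-const-1 (suc m) = trans (cong (_+ 1ℤ) (∑-const-1 m)) (ℤP.+-comm (+ m) 1ℤ)

  geometric : ∀ x m → x ^ m ≡ 1ℤ + (x - 1ℤ) * ∑< m (x ^_)
  geometric x zero    = sym (cong (λ y → 1ℤ + y) (ℤP.*-zeroʳ (x - 1ℤ)))
  geometric x (suc m) = begin
    x * x ^ m                                     ≡⟨ step x (x ^ m) ⟩
    x ^ m + (x - 1ℤ) * x ^ m                      ≡⟨ cong (_+ (x - 1ℤ) * x ^ m) (geometric x m) ⟩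
    1ℤ + (x - 1ℤ) * ∑< m (x ^_) + (x - 1ℤ) * x ^ m ≡⟨ join (x - 1ℤ) (∑< m (x ^_)) (x ^ m) ⟩
    1ℤ + (x - 1ℤ) * (∑< m (x ^_) + x ^ m)         ∎
    where
    open ≡-Reasoning
    step : ∀ x y → x * y ≡ y + (x - 1ℤ) * y
    step = solve-∀
    join : ∀ d s y → 1ℤ + d * s + d * y ≡ 1ℤ + d * (s + y)
    join = solve-∀

  -1^-cases : ∀ m → -1ℤ ^ m ≡ 1ℤ ⊎ -1ℤ ^ m ≡ -1ℤ
  -1^-cases zero = inj₁ refl
  -1^-cases (suc m) with -1^-cases m
  ... | inj₁ e = inj₂ (cong (-1ℤ *_) e)
  ... | inj₂ e = inj₁ (cong (-1ℤ *_) e)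

  monomial-leading : ∀ d → Leading 1ℤ d 1ℤ (λ k → (+ k) ^ d)
  monomial-leading d = subst (λ e → Leading 1ℤ e 1ℤ (λ k → (+ k) ^ d)) (ℕP.+-identityʳ d)
    (leading-cong {1ℤ} {d ℕ.+ 0} {1ℤ} (λ k → trans (ℤP.*-identityʳ _) (cong (_^ d) (lemma (+ k))))
      (leading-linear-^ {1ℤ} {0} {1ℤ} {λ _ → 1ℤ} 0ℤ d (λ _ → refl)))
    where
    lemma : ∀ k → 1ℤ * k + 0ℤ ≡ k
    lemma = solve-∀

  -- Exponents and range lengths are kept subtraction-free: p = s + 4, p₁ = p − 1 and, below,
  -- n = n₃ + 3.
  module Inverse (s : ℕ) (prime : Prime (4 ℕ.+ s)) where
    p₁ : ℕ
    p₁ = 3 ℕ.+ s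

    open Prime-mod p₁ prime public

    P³ : ℤ
    P³ = P * P * P

    -- In x^p - 1 = (x - 1) ∑ x^k the first factor is divisible by m, and the second is ≡ p ≡ 0
    -- modulo p.
    pow-lift : ∀ {x m} → x ≡ 1ℤ [mod P ] → x ≡ 1ℤ [mod m ] → x ^ p ≡ 1ℤ [mod m * P ]
    pow-lift {x} {m} h (congruent t eq) with mod-trans (∑mod.fold-cong P p {x ^_} {λ _ → 1ℤ}
      λ k _ → mod-trans (mod-^ k h) (≡⇒≡mod (ℤP.^-zeroˡ k)))
        (mod-trans (≡⇒≡mod (∑-const-1 p)) (self≡0 P))
    ... | congruent u eq′ = congruent (t * u) (begin
      x ^ p                                  ≡⟨ geometric x p ⟩
      1ℤ + (x - 1ℤ) * ∑< p (x ^_)            ≡⟨ cong₂ (λ a b → 1ℤ + (a - 1ℤ) * b) eq eq′ ⟩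
      1ℤ + (1ℤ + t * m - 1ℤ) * (0ℤ + u * P)  ≡⟨ lemma t u m P ⟩
      1ℤ + t * u * (m * P)                   ∎)
      where
      open ≡-Reasoning
      lemma : ∀ t u m P → 1ℤ + (1ℤ + t * m - 1ℤ) * (0ℤ + u * P) ≡ 1ℤ + t * u * (m * P)
      lemma = solve-∀

    ^p²≡1 : ∀ {x} → x ≡ 1ℤ [mod P ] → x ^ (p ℕ.* p) ≡ 1ℤ [mod P³ ]
    ^p²≡1 {x} h = mod-trans (≡⇒≡mod (sym (ℤP.^-*-assoc x p p)))
      (pow-lift (mod-weaken P h²) h²)
      where
      h² : x ^ p ≡ 1ℤ [mod P * P ]
      h² = pow-lift h h

    opaque

      -- c x = x^((p − 1)p² − 1) is the inverse of x modulo p³ when p ∤ x; being a monomial it is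
      -- multiplicative and p-periodic modulo p.
      c : ℤ → ℤ
      c x = x ^ (2 ℕ.+ s) * (x ^ p₁) ^ (p₁ ℕ.+ p₁ ℕ.* p)

      c-eq : ∀ x → x * c x ≡ (x ^ p₁) ^ (p ℕ.* p)
      -- The exponents add up by computation, 1 + (p₁ + p₁ * p) being p * p, so reassociation
      -- suffices.
      c-eq x = sym (ℤP.*-assoc x (x ^ (2 ℕ.+ s)) ((x ^ p₁) ^ (p₁ ℕ.+ p₁ ℕ.* p)))

      c-cong : ∀ {m x y} → x ≡ y [mod m ] → c x ≡ c y [mod m ]
      c-cong h = mod-* (mod-^ (2 ℕ.+ s) h) (mod-^ (p₁ ℕ.+ p₁ ℕ.* p) (mod-^ p₁ h))

      c-* : ∀ x y → c (x * y) ≡ c x * c y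
      c-* x y = trans (cong₂ _*_ (*-^ x y (2 ℕ.+ s))
          (trans (cong (_^ (p₁ ℕ.+ p₁ ℕ.* p)) (*-^ x y p₁)) (*-^ (x ^ p₁) (y ^ p₁) (p₁ ℕ.+ p₁ ℕ.* p))))
        (lemma (x ^ (2 ℕ.+ s)) (y ^ (2 ℕ.+ s)) ((x ^ p₁) ^ (p₁ ℕ.+ p₁ ℕ.* p)) ((y ^ p₁) ^ (p₁ ℕ.+ p₁ ℕ.* p)))
        where
        lemma : ∀ a b d e → a * b * (d * e) ≡ a * d * (b * e)
        lemma = solve-∀

      c-fermat : ∀ j → Coprime (+ j) → c (+ j) ≡ (+ j) ^ (2 ℕ.+ s) [mod P ]
      c-fermat j cop = mod-trans (mod-*ˡ ((+ j) ^ (2 ℕ.+ s))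
          (mod-trans (mod-^ (p₁ ℕ.+ p₁ ℕ.* p) (fermat-coprime j cop)) (≡⇒≡mod (ℤP.^-zeroˡ (p₁ ℕ.+ p₁ ℕ.* p)))))
        (≡⇒≡mod (ℤP.*-identityʳ ((+ j) ^ (2 ℕ.+ s))))

      c-p : c P ≡ 0ℤ [mod P ]
      c-p = c-cong {P} {P} {0ℤ} (self≡0 P)

    c-inverse : ∀ j → Coprime (+ j) → + j * c (+ j) ≡ 1ℤ [mod P³ ]
    c-inverse j cop = mod-trans (≡⇒≡mod (c-eq (+ j))) (^p²≡1 (fermat-coprime j cop))

    coprime-invertible : ∀ j → Coprime (+ j) → Invertible P³ (+ j)
    coprime-invertible j cop = invertible (c (+ j)) (c-inverse j cop)

    -- Unlike c-inverse this also covers multiples of p.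
    c-absorb : ∀ j → + j * (+ j * c (+ j)) ≡ + j [mod P ]
    c-absorb j = mod-trans (≡⇒≡mod (cong (+ j *_) (c-eq (+ j)))) (iterate (p ℕ.* p))
      where
      iterate : ∀ m → + j * ((+ j) ^ p₁) ^ m ≡ + j [mod P ]
      iterate zero    = ≡⇒≡mod (ℤP.*-identityʳ (+ j))
      iterate (suc m) = mod-trans (≡⇒≡mod (sym (ℤP.*-assoc (+ j) ((+ j) ^ p₁) (((+ j) ^ p₁) ^ m))))
        (mod-trans (mod-*ʳ (((+ j) ^ p₁) ^ m) (fermat j)) (iterate m))

    -- The exponent 2(p - 2) = (p - 1) + (p - 3) loses p - 1 by Fermat.
    c²-fermat : ∀ j → Coprime (+ j) → c (+ j) * c (+ j) ≡ (+ j) ^ suc s [mod P ]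
    c²-fermat j cop = begin
      c (+ j) * c (+ j)                          ≈⟨ mod-* (c-fermat j cop) (c-fermat j cop) ⟩
      (+ j) ^ (2 ℕ.+ s) * (+ j) ^ (2 ℕ.+ s)      ≡⟨ lemma (+ j) ((+ j) ^ suc s) ⟩
      (+ j) ^ p₁ * (+ j) ^ suc s                 ≈⟨ mod-*ʳ ((+ j) ^ suc s) (fermat-coprime j cop) ⟩
      1ℤ * (+ j) ^ suc s                         ≡⟨ ℤP.*-identityˡ ((+ j) ^ suc s) ⟩
      (+ j) ^ suc s                              ∎
      where
      open ModReasoning P
      lemma : ∀ x y → x * y * (x * y) ≡ x * (x * y) * y
      lemma = solve-∀

    -- Parity is read off from `alt≡1` at the last index, where the binomial coefficient is 1; the
    -- sign -1 would force 2 ≡ 0.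
    even-sign : -1ℤ ^ p₁ ≡ 1ℤ
    even-sign with -1^-cases p₁
    ... | inj₁ e = e
    ... | inj₂ e = ⊥-elim (coprime-< 1 (s≤s (s≤s (s≤s z≤n))) (mod-sym (mod-trans
          (≡⇒≡mod refl) (mod-+ʳ 1ℤ (mod-trans (≡⇒≡mod (sym e))
            (mod-trans (≡⇒≡mod (trans (sym (ℤP.*-identityˡ (-1ℤ ^ p₁))) (cong (_* -1ℤ ^ p₁) (sym (binom-diag p₁)))))
              (alt≡1 p₁ ℕP.≤-refl)))))))

    alt-last : alt p₁ p₁ ≡ 1ℤ
    alt-last = trans (cong₂ _*_ (binom-diag p₁) even-sign) refl

    power-sum : ∀ d → Leading 1ℤ p₁ 0ℤ (λ k → (+ k) ^ suc d) →
      ∑< p₁ (λ j → (+ suc j) ^ suc d) ≡ 0ℤ [mod P ]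
    power-sum d l = begin
      -- The term at j = 0 may be added because the exponent is positive; this completes the range
      -- to a full period.
      ∑< p₁ (λ j → (+ suc j) ^ suc d)              ≡⟨ ℤP.+-identityˡ _ ⟨
      0ℤ + ∑< p₁ (λ j → (+ suc j) ^ suc d)         ≡⟨ ∑.fold-head p₁ (λ j → (+ j) ^ suc d) ⟨
      ∑< p (λ j → (+ j) ^ suc d)                   ≈⟨ ∑-∇ (λ j → (+ j) ^ suc d) ⟩
      ∇ p₁ (λ j → (+ j) ^ suc d) 0                 ≡⟨ l 0 ⟩
      0ℤ                                           ∎
      where open ModReasoning P

    -- Harmonic sums of orders one and two, with `c` as reciprocal.
    h H : ℕ → ℤ
    h k = ∑< k (λ j → c (+ suc j))
    H k = ∑< k (λ j → c (+ suc j) * c (+ suc j))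

    -- Fermat replaces 1/j by j^(p-2), of degree below p - 1; for `H-total` the exponent is p - 3.
    h-total : h p₁ ≡ 0ℤ [mod P ]
    h-total = mod-trans (∑mod.fold-cong P p₁ (λ j j<p₁ → c-fermat (suc j) (coprime-< j (s≤s j<p₁))))
      (power-sum (suc s) (leading-raise {1ℤ} {2 ℕ.+ s} {1ℤ} (monomial-leading (2 ℕ.+ s))))

    H-total : H p₁ ≡ 0ℤ [mod P ]
    H-total = mod-trans (∑mod.fold-cong P p₁ (λ j j<p₁ → c²-fermat (suc j) (coprime-< j (s≤s j<p₁))))
      (power-sum s (leading-raise {1ℤ} {2 ℕ.+ s} {0ℤ} (leading-raise {1ℤ} {1 ℕ.+ s} {1ℤ} (monomial-leading (1 ℕ.+ s)))))

    -- The (p-1)-st difference of x^(p-1) at 0 is computed twice: as (p - 1)! from the leading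
    -- coefficient, and modulo p as a sum of p - 1 ones.
    wilson : fact p₁ ≡ -1ℤ [mod P ]
    wilson = begin
      fact p₁                              ≡⟨ ℤP.*-identityˡ (fact p₁) ⟨
      1ℤ * fact p₁                         ≡⟨ cong (_* fact p₁) (trans (ℤP.*-identityˡ (-1ℤ ^ p₁)) even-sign) ⟨
      1ℤ * -1ℤ ^ p₁ * fact p₁              ≡⟨ monomial-leading p₁ 0 ⟨
      ∇ p₁ (λ j → (+ j) ^ p₁) 0            ≈⟨ ∑-∇ (λ j → (+ j) ^ p₁) ⟨
      ∑< p (λ j → (+ j) ^ p₁)              ≡⟨ ∑.fold-head p₁ (λ j → (+ j) ^ p₁) ⟩
      0ℤ + ∑< p₁ (λ j → (+ suc j) ^ p₁)    ≡⟨ ℤP.+-identityˡ _ ⟩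
      ∑< p₁ (λ j → (+ suc j) ^ p₁)
        ≈⟨ ∑mod.fold-cong P p₁ (λ j j<p₁ → fermat-coprime (suc j) (coprime-< j (s≤s j<p₁))) ⟩
      ∑< p₁ (λ _ → 1ℤ)                     ≡⟨ ∑-const-1 p₁ ⟩
      + p₁                                 ≡⟨⟩
      -1ℤ + P                              ≈⟨ mod-+ˡ -1ℤ (self≡0 P) ⟩
      -1ℤ                                  ∎
      where open ModReasoning P

    -- j² - j′² has the factor j + j′ = p, and `c` is multiplicative and respects congruence.
    c²-reflect : ∀ j j′ → j ℕ.+ j′ ≡ p → c (+ j) * c (+ j) ≡ c (+ j′) * c (+ j′) [mod P ]
    c²-reflect j j′ e = begin
      c (+ j) * c (+ j)      ≡⟨ c-* (+ j) (+ j) ⟨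
      c (+ j * + j)          ≈⟨ c-cong {P} {+ j * + j} {+ j′ * + j′} squares ⟩
      c (+ j′ * + j′)        ≡⟨ c-* (+ j′) (+ j′) ⟩
      c (+ j′) * c (+ j′)    ∎
      where
      open ModReasoning P
      difference : ∀ x y → x * x ≡ y * y + (x - y) * (x + y)
      difference = solve-∀
      squares : + j * + j ≡ + j′ * + j′ [mod P ]
      squares = congruent (+ j - + j′) (trans (difference (+ j) (+ j′))
        (cong (λ z → + j′ * + j′ + (+ j - + j′) * z) (cong +_ e)))

    -- Each step trades the last term of the first sum for the congruent next term of the second,
    -- until the second is the whole sum `H p₁` ≡ 0.
    H-reflect : ∀ k k′ → k ℕ.+ k′ ≡ p₁ → H k + H k′ ≡ 0ℤ [mod P ]
    H-reflect zero    k′ refl = mod-trans (≡⇒≡mod (ℤP.+-identityˡ (H k′))) H-total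
    H-reflect (suc k) k′ e = begin
      H k + q k + H k′       ≈⟨ mod-+ʳ (H k′) (mod-+ˡ (H k) (c²-reflect (suc k) (suc k′)
                                  (cong suc (trans (ℕP.+-suc k k′) e)))) ⟩
      H k + q k′ + H k′      ≡⟨ lemma (H k) (q k′) (H k′) ⟩
      H k + (H k′ + q k′)    ≈⟨ H-reflect k (suc k′) (trans (ℕP.+-suc k k′) e) ⟩
      0ℤ                     ∎
      where
      open ModReasoning P
      q : ℕ → ℤ
      q j = c (+ suc j) * c (+ suc j)
      lemma : ∀ a b d → a + b + d ≡ a + (d + b)
      lemma = solve-∀

    -- A full period adds `H p₁` ≡ 0 and the term at p, where `c` vanishes modulo p.
    H-periodic : ∀ k → H (p ℕ.+ k) ≡ H k [mod P ]
    H-periodic k = begin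
      H (p ℕ.+ k)                               ≡⟨ ∑.fold-++ p k q ⟩
      H p₁ + q p₁ + ∑< k (λ j → q (p ℕ.+ j))
        ≈⟨ mod-+ (mod-+ H-total (mod-* c-p c-p)) (∑mod.fold-cong P k λ j _ → mod-* (period j) (period j)) ⟩
      0ℤ + 0ℤ * 0ℤ + H k                        ≡⟨ ℤP.+-identityˡ (H k) ⟩
      H k                                       ∎
      where
      open ModReasoning P
      q : ℕ → ℤ
      q j = c (+ suc j) * c (+ suc j)
      shift : ∀ x → 1ℤ + (P + x) ≡ 1ℤ + x + 1ℤ * P
      shift = λ x → shift′ P x
        where
        shift′ : ∀ P x → 1ℤ + (P + x) ≡ 1ℤ + x + 1ℤ * P
        shift′ = solve-∀
      period : ∀ j → c (+ suc (p ℕ.+ j)) ≡ c (+ suc j) [mod P ]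
      period j = c-cong {P} {+ suc (p ℕ.+ j)} {+ suc j} (congruent 1ℤ (shift (+ j)))

  -- Vanishing of the error term modulo p

  module Vanishing (s : ℕ) (prime : Prime (4 ℕ.+ s)) (n₃ r : ℕ) (p₁≡rn : 3 ℕ.+ s ≡ r ℕ.* (3 ℕ.+ n₃)) where

    open Inverse s prime public

    n : ℕ
    n = 3 ℕ.+ n₃

    N : ℤ
    N = + n

    Nr+1 : N * + r + 1ℤ ≡ P
    Nr+1 = begin
      N * + r + 1ℤ           ≡⟨ cong (_+ 1ℤ) (ℤP.pos-* n r) ⟨
      + (n ℕ.* r) + 1ℤ       ≡⟨ cong (λ x → + x + 1ℤ) (ℕP.*-comm n r) ⟩
      + (r ℕ.* n) + 1ℤ       ≡⟨ cong (λ x → + x + 1ℤ) p₁≡rn ⟨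
      + p₁ + 1ℤ              ≡⟨ ℤP.+-comm (+ p₁) 1ℤ ⟩
      P                      ∎
      where open ≡-Reasoning

    q : ℕ → ℤ
    q k = ∏< r (λ i → N * + k + (N * + suc i + 1ℤ))

    -- The product (k + 1)⋯(k + r), in the shape that `leading-∏^` expects; up to a power of ±n it
    -- is what `q` becomes modulo p after either substitution.
    G : ℕ → ℕ → ℤ
    G r k = ∏< r (λ i → 1ℤ * + k + + suc i)

    -- The polynomial G(x)ⁿ ∑_{i<r} (x + 1 + i)⁻².
    B : ℕ → ℕ → ℤ
    B zero    k = 0ℤ
    B (suc r) k = (1ℤ * + k + + suc r) ^ n * B r k + (1ℤ * + k + + suc r) ^ suc n₃ * G r k ^ n

    -- Cancelling a square from an n-th power costs two degrees, so the second summand is raised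
    -- twice with coefficient 0.
    B-leading : ∀ r → Leading 1ℤ (r ℕ.* n) 0ℤ (B r)
    B-leading zero    k = refl
    B-leading (suc r) = leading-+ {1ℤ} {n ℕ.+ r ℕ.* n} {0ℤ} {0ℤ}
      (leading-linear-^ {1ℤ} {r ℕ.* n} {0ℤ} (+ suc r) n (B-leading r))
      (leading-raise {1ℤ} {2 ℕ.+ n₃ ℕ.+ r ℕ.* n} {0ℤ}
        (leading-raise {1ℤ} {1 ℕ.+ n₃ ℕ.+ r ℕ.* n} {1ℤ}
          (leading-linear-^ {1ℤ} {r ℕ.* n} {1ℤ} (+ suc r) (suc n₃) (leading-∏^ {1ℤ} (λ i → + suc i) n r))))

    H-difference : ∀ r k → G r k ^ n * (H (r ℕ.+ k) - H k) ≡ B r k [mod P ]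
    H-difference zero k = ≡⇒≡mod (trans (cong (1ℤ ^ n *_) (ℤP.+-inverseʳ (H k))) (ℤP.*-zeroʳ (1ℤ ^ n)))
    H-difference (suc r) k = begin
      (G r k * x) ^ n * (H (r ℕ.+ k) + c y * c y - H k)
        ≡⟨ cong (_* (H (r ℕ.+ k) + c y * c y - H k)) (*-^ (G r k) x n) ⟩
      G r k ^ n * x ^ n * (H (r ℕ.+ k) + c y * c y - H k)
        ≡⟨ cong (λ y → G r k ^ n * x ^ n * (H (r ℕ.+ k) + c y * c y - H k)) y≡x ⟩
      G r k ^ n * x ^ n * (H (r ℕ.+ k) + c x * c x - H k)
        ≡⟨ expand (G r k ^ n) x (x ^ n₃) (H (r ℕ.+ k)) (c x) (H k) ⟩
      x ^ n * (G r k ^ n * (H (r ℕ.+ k) - H k)) + x ^ n₃ * (x * (x * c x) * (x * c x)) * G r k ^ n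
        -- Two reciprocals are absorbed by three factors `x`; the spare one makes this valid also
        -- when p divides `x`, and n ≥ 3 supplies it.
        ≈⟨ mod-+ (mod-*ˡ (x ^ n) (H-difference r k))
                 (mod-*ʳ (G r k ^ n) (mod-*ˡ (x ^ n₃) (mod-trans (mod-*ʳ (x * c x) absorb) absorb))) ⟩
      x ^ n * B r k + x ^ n₃ * x * G r k ^ n
        ≡⟨ cong (λ z → x ^ n * B r k + z * G r k ^ n) (ℤP.*-comm (x ^ n₃) x) ⟩
      B (suc r) k ∎
      where
      open ModReasoning P
      x = 1ℤ * + k + + suc r
      y = + suc (r ℕ.+ k)
      y≡x : y ≡ x
      y≡x = trans (cong +_ (ℕP.+-comm (suc r) k)) (cong (_+ + suc r) (sym (ℤP.*-identityˡ (+ k))))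
      absorb : x * (x * c x) ≡ x [mod P ]
      absorb = subst (λ x → x * (x * c x) ≡ x [mod P ]) y≡x (c-absorb (suc (r ℕ.+ k)))
      expand : ∀ g x x₃ h c h′ → g * (x * (x * (x * x₃))) * (h + c * c - h′)
        ≡ x * (x * (x * x₃)) * (g * (h - h′)) + x₃ * (x * (x * c) * (x * c)) * g
      expand = solve-∀

    N^p₁ : ℤ
    N^p₁ = N ^ p₁

    -N^p₁ : (- N) ^ p₁ ≡ N^p₁
    -N^p₁ = trans (cong (_^ p₁) (sym (ℤP.-1*i≡-i N))) (trans (*-^ -1ℤ N p₁)
      (trans (cong (_* N^p₁) even-sign) (ℤP.*-identityˡ N^p₁)))

    -- Replacing k by k + r adds nr = p - 1 to each factor, which removes its summand 1 modulo p.
    q-shift : ∀ k → q (r ℕ.+ k) ^ n ≡ N^p₁ * G r k ^ n [mod P ]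
    q-shift k = begin
      q (r ℕ.+ k) ^ n
        ≈⟨ mod-^ n (∏mod.fold-cong P r λ i _ → congruent 1ℤ (factor i)) ⟩
      ∏< r (λ i → N * (1ℤ * + k + + suc i)) ^ n
        ≡⟨ cong (_^ n) (∏.fold-∙ r (λ _ → N) (λ i → 1ℤ * + k + + suc i)) ⟩
      (∏< r (λ _ → N) * G r k) ^ n
        ≡⟨ cong (λ x → (x * G r k) ^ n) (∏-const N r) ⟩
      (N ^ r * G r k) ^ n
        ≡⟨ *-^ (N ^ r) (G r k) n ⟩
      (N ^ r) ^ n * G r k ^ n
        ≡⟨ cong (_* G r k ^ n) (trans (ℤP.^-*-assoc N r n) (cong (N ^_) (sym p₁≡rn))) ⟩
      N^p₁ * G r k ^ n ∎
      where
      open ModReasoning P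
      ring : ∀ N r k i → N * (r + k) + (N * i + 1ℤ) ≡ N * (1ℤ * k + i) + 1ℤ * (N * r + 1ℤ)
      ring = solve-∀
      factor : ∀ i → N * + (r ℕ.+ k) + (N * + suc i + 1ℤ) ≡ N * (1ℤ * + k + + suc i) + 1ℤ * P
      factor i = trans (ring N (+ r) (+ k) (+ suc i)) (cong (λ z → N * (1ℤ * + k + + suc i) + 1ℤ * z) Nr+1)

    -- The inner index is reversed as well: a factor of `q k` and the mirrored n(k′ + i′ + 1) add up
    -- to (nr + 1) + np = (1 + n)p. The sign disappears because rn = p - 1 is even.
    q-reflect : ∀ k k′ → suc (k ℕ.+ k′) ≡ p → q k ^ n ≡ N^p₁ * G r k′ ^ n [mod P ]
    q-reflect k k′ e = begin
      q k ^ n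
        ≈⟨ mod-^ n (∏mod.fold-reverse P r λ i i′ e′ → congruent (1ℤ + N) (factor i i′ e′)) ⟩
      ∏< r (λ i → - N * (1ℤ * + k′ + + suc i)) ^ n
        ≡⟨ cong (_^ n) (∏.fold-∙ r (λ _ → - N) (λ i → 1ℤ * + k′ + + suc i)) ⟩
      (∏< r (λ _ → - N) * G r k′) ^ n
        ≡⟨ cong (λ x → (x * G r k′) ^ n) (∏-const (- N) r) ⟩
      ((- N) ^ r * G r k′) ^ n
        ≡⟨ *-^ ((- N) ^ r) (G r k′) n ⟩
      ((- N) ^ r) ^ n * G r k′ ^ n
        ≡⟨ cong (_* G r k′ ^ n) (trans (ℤP.^-*-assoc (- N) r n) (cong ((- N) ^_) (sym p₁≡rn))) ⟩
      (- N) ^ p₁ * G r k′ ^ n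
        ≡⟨ cong (_* G r k′ ^ n) -N^p₁ ⟩
      N^p₁ * G r k′ ^ n ∎
      where
      open ModReasoning P
      ring : ∀ N k k′ i i′ → N * k + (N * (1ℤ + i) + 1ℤ)
        ≡ - N * (1ℤ * k′ + (1ℤ + i′)) + ((N * (1ℤ + (i + i′)) + 1ℤ) + N * (1ℤ + (k + k′)))
      ring = solve-∀
      collect : ∀ N P → P + N * P ≡ (1ℤ + N) * P
      collect = solve-∀
      factor : ∀ i i′ → suc (i ℕ.+ i′) ≡ r →
        N * + k + (N * + suc i + 1ℤ) ≡ - N * (1ℤ * + k′ + + suc i′) + (1ℤ + N) * P
      factor i i′ e′ = trans (ring N (+ k) (+ k′) (+ i) (+ i′)) (cong (λ z → - N * (1ℤ * + k′ + + suc i′) + z)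
        (trans (cong₂ _+_ (trans (cong (λ j → N * + j + 1ℤ) e′) Nr+1) (cong (λ j → N * + j) e)) (collect N P)))

    ∑-shift : ∀ f → (∀ k → f (p ℕ.+ k) ≡ f k [mod P ]) → ∀ j → ∑< p (λ k → f (j ℕ.+ k)) ≡ ∑< p f [mod P ]
    ∑-shift f periodic zero    = ≡⇒≡mod refl
    ∑-shift f periodic (suc j) = begin
      ∑< p (λ k → f (suc j ℕ.+ k))   ≡⟨ ∑.fold-cong p (λ k _ → cong f (sym (ℕP.+-suc j k))) ⟩
      ∑< p (g ∘ suc)                 ≡⟨ add-sub (g 0) (∑< p (g ∘ suc)) ⟩
      g 0 + ∑< p (g ∘ suc) - g 0     ≡⟨ cong (_- g 0) (∑.fold-head p g) ⟨
      ∑< p g + g p - g 0             ≈⟨ mod-+ʳ (- g 0) (mod-+ˡ (∑< p g) wrap) ⟩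
      ∑< p g + g 0 - g 0             ≡⟨ cancel (∑< p g) (g 0) ⟩
      ∑< p g                         ≈⟨ ∑-shift f periodic j ⟩
      ∑< p f                         ∎
      where
      open ModReasoning P
      g : ℕ → ℤ
      g k = f (j ℕ.+ k)
      wrap : g p ≡ g 0 [mod P ]
      wrap = mod-trans (≡⇒≡mod (cong f (trans (ℕP.+-comm j p) (cong (p ℕ.+_) (sym (ℕP.+-identityʳ j))))))
        (periodic (j ℕ.+ 0))
      add-sub : ∀ a b → b ≡ a + b - a
      add-sub = solve-∀
      cancel : ∀ a b → a + b - b ≡ a
      cancel = solve-∀

    qⁿH : ℕ → ℤ
    qⁿH k = q k ^ n * H k

    qⁿH-periodic : ∀ k → qⁿH (p ℕ.+ k) ≡ qⁿH k [mod P ]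
    qⁿH-periodic k = mod-* (mod-^ n (∏mod.fold-cong P r λ i _ → congruent N (lemma N P (+ k) (N * + suc i + 1ℤ))))
      (H-periodic k)
      where
      lemma : ∀ N P k e → N * (P + k) + e ≡ N * k + e + N * P
      lemma = solve-∀

    ∑qⁿH≡0 : ∑< p qⁿH ≡ 0ℤ [mod P ]
    ∑qⁿH≡0 = coprime-cancel (coprime-< 1 (s≤s (s≤s (s≤s z≤n)))) (begin
      + 2 * S
        ≡⟨ double S ⟩
      S + S
        -- One copy is shifted by r and the other reflected; both acquire the weight n^(p-1) G(k)ⁿ,
        -- and the reflection turns H into -H, so that the two values of H subtract.
        ≈⟨ mod-+ (mod-sym (∑-shift qⁿH qⁿH-periodic r)) (∑mod.fold-reverse P p reflect) ⟩
      ∑< p (λ k → qⁿH (r ℕ.+ k)) + ∑< p (λ k → N^p₁ * G r k ^ n * - H k)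
        ≡⟨ ∑.fold-∙ p (λ k → qⁿH (r ℕ.+ k)) (λ k → N^p₁ * G r k ^ n * - H k) ⟨
      ∑< p (λ k → qⁿH (r ℕ.+ k) + N^p₁ * G r k ^ n * - H k)
        ≈⟨ ∑mod.fold-cong P p (λ k _ → combine k) ⟩
      ∑< p (λ k → N^p₁ * B r k)
        ≡⟨ ∑-*ˡ N^p₁ p (B r) ⟨
      N^p₁ * ∑< p (B r)
        ≈⟨ mod-≡0-* N^p₁ (mod-trans (∑-∇ (B r)) (≡⇒≡mod (subst (λ d → Leading 1ℤ d 0ℤ (B r)) (sym p₁≡rn) (B-leading r) 0))) ⟩
      0ℤ ∎)
      where
      open ModReasoning P
      S = ∑< p qⁿH
      double : ∀ x → + 2 * x ≡ x + x
      double = solve-∀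
      negate : ∀ x y → x ≡ x + y + - y
      negate = solve-∀
      reflect : ∀ k k′ → suc (k ℕ.+ k′) ≡ p → qⁿH k ≡ N^p₁ * G r k′ ^ n * - H k′ [mod P ]
      reflect k k′ e = mod-* (q-reflect k k′ e) (mod-trans (≡⇒≡mod (negate (H k) (H k′)))
        (mod-trans (mod-+ʳ (- H k′) (H-reflect k k′ (ℕP.suc-injective e))) (≡⇒≡mod (ℤP.+-identityˡ (- H k′)))))
      factor : ∀ a g h h′ → a * g * h + a * g * - h′ ≡ a * (g * (h - h′))
      factor = solve-∀
      combine : ∀ k → qⁿH (r ℕ.+ k) + N^p₁ * G r k ^ n * - H k ≡ N^p₁ * B r k [mod P ]
      combine k = mod-trans (mod-+ʳ (N^p₁ * G r k ^ n * - H k) (mod-*ʳ (H (r ℕ.+ k)) (q-shift k)))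
        (mod-trans (≡⇒≡mod (factor N^p₁ (G r k ^ n) (H (r ℕ.+ k)) (H k))) (mod-*ˡ N^p₁ (H-difference r k)))

  -- Wolstenholme's theorem and expansions modulo p³

  ∏-^ : ∀ m f k → ∏< k f ^ m ≡ ∏< k (λ j → f j ^ m)
  ∏-^ m f zero    = ℤP.^-zeroˡ m
  ∏-^ m f (suc k) = trans (*-^ (∏< k f) (f k) m) (cong (_* f k ^ m) (∏-^ m f k))

  ∏-factor-fact : ∀ {m} k f g → (∀ j → j ℕ.< k → f j ≡ + suc j * g j [mod m ]) → ∏< k f ≡ fact k * ∏< k g [mod m ]
  ∏-factor-fact {m} k f g h = mod-trans (∏mod.fold-cong m k h) (≡⇒≡mod (∏.fold-∙ k (λ j → + suc j) g))

  -- The coefficient m(m - 1)/2, defined by recursion to stay free of division.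
  triangle : ℕ → ℤ
  triangle zero    = 0ℤ
  triangle (suc m) = triangle m + + m

  binomial-cubic : ∀ {M y} → y * y * y ≡ 0ℤ [mod M ] → ∀ m →
    (1ℤ + y) ^ m ≡ 1ℤ + + m * y + triangle m * (y * y) [mod M ]
  binomial-cubic {M} {y} y³ zero = ≡⇒≡mod refl
  binomial-cubic {M} {y} y³ (suc m) = begin
    (1ℤ + y) * (1ℤ + y) ^ m
      ≈⟨ mod-*ˡ (1ℤ + y) (binomial-cubic y³ m) ⟩
    (1ℤ + y) * (1ℤ + + m * y + triangle m * (y * y))
      ≡⟨ expand y (+ m) (triangle m) ⟩
    1ℤ + (1ℤ + + m) * y + (triangle m + + m) * (y * y) + triangle m * (y * y * y)
      ≈⟨ mod-+ˡ (1ℤ + + suc m * y + triangle (suc m) * (y * y)) (mod-≡0-* (triangle m) y³) ⟩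
    1ℤ + + suc m * y + triangle (suc m) * (y * y) + 0ℤ
      ≡⟨ ℤP.+-identityʳ _ ⟩
    1ℤ + + suc m * y + triangle (suc m) * (y * y) ∎
    where
    open ModReasoning M
    expand : ∀ y m t → (1ℤ + y) * (1ℤ + m * y + t * (y * y))
      ≡ 1ℤ + (1ℤ + m) * y + (t + m) * (y * y) + t * (y * y * y)
    expand = solve-∀

  module Wolstenholme (s : ℕ) (prime : Prime (4 ℕ.+ s)) where
    open Inverse s prime

    -- Second elementary symmetric function of the reciprocals of 1, ..., k.
    e₂ : ℕ → ℤ
    e₂ zero    = 0ℤ
    e₂ (suc k) = e₂ k + h k * c (+ suc k)

    -- Newton's identity; through it `e₂ p₁` vanishes modulo p along with `h p₁` and `H p₁`.
    h² : ∀ k → + 2 * e₂ k ≡ h k * h k - H k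
    h² zero    = refl
    h² (suc k) = trans (distribute (e₂ k) (h k) x)
      (trans (cong (_+ + 2 * (h k * x)) (h² k)) (square (h k) (H k) x))
      where
      x = c (+ suc k)
      distribute : ∀ e h x → + 2 * (e + h * x) ≡ + 2 * e + + 2 * (h * x)
      distribute = solve-∀
      square : ∀ h H x → h * h - H + + 2 * (h * x) ≡ (h + x) * (h + x) - (H + x * x)
      square = solve-∀

    e₂-total : e₂ p₁ ≡ 0ℤ [mod P ]
    e₂-total = coprime-cancel (coprime-< 1 (s≤s (s≤s (s≤s z≤n))))
      (mod-trans (≡⇒≡mod (h² p₁)) (mod-+ (mod-* h-total h-total) (mod-neg H-total)))

    -- Terms of degree three and more in b carry p³, so only `h` and `e₂` are seen.
    ∏-expand : ∀ b k → ∏< k (λ j → 1ℤ + b * P * c (+ suc j)) ≡ 1ℤ + b * (P * h k) + b * b * (P * P * e₂ k) [mod P³ ]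
    ∏-expand b zero    = ≡⇒≡mod (sym (lemma b P))
      where
      lemma : ∀ b P → 1ℤ + b * (P * 0ℤ) + b * b * (P * P * 0ℤ) ≡ 1ℤ
      lemma = solve-∀
    ∏-expand b (suc k) = mod-trans (mod-*ʳ (1ℤ + b * P * x) (∏-expand b k))
      (congruent (b * b * b * e₂ k * x) (lemma b P (h k) (e₂ k) x))
      where
      x = c (+ suc k)
      lemma : ∀ b P h e x → (1ℤ + b * (P * h) + b * b * (P * P * e)) * (1ℤ + b * P * x)
        ≡ 1ℤ + b * (P * (h + x)) + b * b * (P * P * (e + h * x)) + b * b * b * e * x * (P * P * P)
      lemma = solve-∀

    fact-invertible : ∀ k → k ℕ.< p → Invertible P³ (fact k)
    fact-invertible k k<p = inv-∏ k (λ j → + suc j)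
      λ j j<k → coprime-invertible (suc j) (coprime-< j (ℕP.<-≤-trans (s≤s j<k) k<p))

    shifted-fact : ∀ b k → k ℕ.< p →
      ∏< k (λ j → + suc j + b * P) ≡ fact k * ∏< k (λ j → 1ℤ + b * P * c (+ suc j)) [mod P³ ]
    shifted-fact b k k<p = ∏-factor-fact k (λ j → + suc j + b * P) (λ j → 1ℤ + b * P * c (+ suc j)) λ j j<k → begin
      + suc j + b * P                          ≡⟨ one (+ suc j) (b * P) ⟩
      + suc j + b * P * 1ℤ                     ≈⟨ mod-+ˡ (+ suc j) (mod-*ˡ (b * P)
                                                    (c-inverse (suc j) (coprime-< j (ℕP.<-≤-trans (s≤s j<k) k<p)))) ⟨
      + suc j + b * P * (+ suc j * c (+ suc j)) ≡⟨ factor (+ suc j) (b * P) (c (+ suc j)) ⟩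
      + suc j * (1ℤ + b * P * c (+ suc j))     ∎
      where
      open ModReasoning P³
      one : ∀ x y → x + y ≡ x + y * 1ℤ
      one = solve-∀
      factor : ∀ x y c → x + y * (x * c) ≡ x * (1ℤ + y * c)
      factor = solve-∀

    P²e₂≡0 : P * P * e₂ p₁ ≡ 0ℤ [mod P³ ]
    P²e₂≡0 = mod-trans (mod-scale (P * P) e₂-total) (≡⇒≡mod (ℤP.*-zeroʳ (P * P)))

    alt≡∏ : ∀ k → k ℕ.< p → alt p₁ k ≡ ∏< k (λ j → 1ℤ + -1ℤ * P * c (+ suc j)) [mod P³ ]
    alt≡∏ k k<p = inv-cancel (fact-invertible k k<p) (begin
      fact k * alt p₁ k                 ≡⟨ ℤP.*-comm (fact k) (alt p₁ k) ⟩
      alt p₁ k * fact k                 ≡⟨ alt-fact p₁ k ⟩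
      ∏< k (λ j → + suc j - P)          ≡⟨ ∏.fold-cong k (λ j _ → cong (λ z → + suc j + z) (sym (ℤP.-1*i≡-i P))) ⟩
      ∏< k (λ j → + suc j + -1ℤ * P)    ≈⟨ shifted-fact -1ℤ k k<p ⟩
      fact k * ∏< k (λ j → 1ℤ + -1ℤ * P * c (+ suc j)) ∎)
      where open ModReasoning P³

    -- The expansion at b = −1 is known exactly, which forces the linear term to vanish.
    Ph≡0 : P * h p₁ ≡ 0ℤ [mod P³ ]
    Ph≡0 = begin
      P * h p₁
        ≡⟨ solve-for (P * h p₁) (P * P * e₂ p₁) ⟩
      1ℤ + P * P * e₂ p₁ - (1ℤ + -1ℤ * (P * h p₁) + -1ℤ * -1ℤ * (P * P * e₂ p₁))
        ≈⟨ mod-+ (mod-+ˡ 1ℤ P²e₂≡0) (mod-neg (mod-trans (mod-sym (∏-expand -1ℤ p₁))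
             (mod-trans (mod-sym (alt≡∏ p₁ ℕP.≤-refl)) (≡⇒≡mod alt-last)))) ⟩
      0ℤ ∎
      where
      open ModReasoning P³
      solve-for : ∀ x y → x ≡ 1ℤ + y - (1ℤ + -1ℤ * x + -1ℤ * -1ℤ * y)
      solve-for = solve-∀

    -- `Ph≡0` and `P²e₂≡0` do not involve b, so what was learnt at b = -1 applies to every b. In
    -- `pc-multiple` this makes all blocks between consecutive multiples of p contribute equally.
    wolstenholme : ∀ b → ∏< p₁ (λ j → + suc j + b * P) ≡ fact p₁ [mod P³ ]
    wolstenholme b = begin
      ∏< p₁ (λ j → + suc j + b * P)
        ≈⟨ shifted-fact b p₁ ℕP.≤-refl ⟩
      fact p₁ * ∏< p₁ (λ j → 1ℤ + b * P * c (+ suc j))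
        ≈⟨ mod-*ˡ (fact p₁) (∏-expand b p₁) ⟩
      fact p₁ * (1ℤ + b * (P * h p₁) + b * b * (P * P * e₂ p₁))
        ≈⟨ mod-*ˡ (fact p₁) (mod-+ (mod-+ˡ 1ℤ (mod-≡0-* b Ph≡0)) (mod-≡0-* (b * b) P²e₂≡0)) ⟩
      fact p₁ * 1ℤ
        ≡⟨ ℤP.*-identityʳ (fact p₁) ⟩
      fact p₁ ∎
      where open ModReasoning P³

  module Expansion (s : ℕ) (prime : Prime (4 ℕ.+ s)) (n₃ r : ℕ) (p₁≡rn : 3 ℕ.+ s ≡ r ℕ.* (3 ℕ.+ n₃)) where
    open Vanishing s prime n₃ r p₁≡rn public
    open Wolstenholme s prime public

    N-coprime : Coprime N
    N-coprime h = coprime-< 0 (s≤s (s≤s z≤n)) (mod-trans (mod-sym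
      (mod-trans (mod-+ʳ 1ℤ (mod-trans (≡⇒≡mod (ℤP.*-comm N (+ r))) (mod-≡0-* (+ r) h))) (≡⇒≡mod refl)))
      (mod-trans (≡⇒≡mod Nr+1) (self≡0 P)))

    -- Put y = p/(nj) and t = n(n − 1)/2.  Then (1 + y)ⁿ ≡ 1 + ny + ty² modulo p³, and
    -- (1 + ny + ty²)(1 − ny)(1 + (n² − t)y²) ≡ 1; hence ε n² = n² − t.
    ε : ℤ
    ε = 1ℤ - triangle n * (c N * c N)

    -- One factor of the ratio, multiplied out instead of divided. The product over j then splits
    -- into `alt`, through `alt≡∏`, and an ε-part.
    local-expansion : ∀ j → suc j ℕ.< p →
      (N * + suc j) ^ n ≡ (N * + suc j + P) ^ n *
        ((1ℤ + -1ℤ * P * c (+ suc j)) * (1ℤ + ε * (P * P) * (c (+ suc j) * c (+ suc j)))) [mod P³ ]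
    local-expansion j j<p = mod-sym (begin
      (N * x + P) ^ n * ((1ℤ + -1ℤ * P * c x) * (1ℤ + ε * (P * P) * (c x * c x)))
        ≈⟨ mod-* (mod-^ n base) (mod-* (mod-+ˡ 1ℤ first) (mod-+ˡ 1ℤ second)) ⟩
      (N * x * (1ℤ + y)) ^ n * ((1ℤ + - (N * y)) * (1ℤ + δ * (y * y)))
        ≡⟨ cong (_* ((1ℤ + - (N * y)) * (1ℤ + δ * (y * y)))) (*-^ (N * x) (1ℤ + y) n) ⟩
      (N * x) ^ n * (1ℤ + y) ^ n * ((1ℤ + - (N * y)) * (1ℤ + δ * (y * y)))
        ≈⟨ mod-*ʳ ((1ℤ + - (N * y)) * (1ℤ + δ * (y * y))) (mod-*ˡ ((N * x) ^ n) (binomial-cubic {P³} {y} y³≡0 n)) ⟩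
      (N * x) ^ n * (1ℤ + N * y + t * (y * y)) * ((1ℤ + - (N * y)) * (1ℤ + δ * (y * y)))
        -- The coefficients of y and y² cancel identically; all that remains beyond the leading term
        -- is a multiple of y³.
        ≡⟨ collect ((N * x) ^ n) N y t ⟩
      (N * x) ^ n + (N * x) ^ n * (- (N * t) - δ * δ * y - N * t * δ * (y * y)) * (y * y * y)
        ≈⟨ mod-+ˡ ((N * x) ^ n) (mod-≡0-* ((N * x) ^ n * (- (N * t) - δ * δ * y - N * t * δ * (y * y))) y³≡0) ⟩
      (N * x) ^ n + 0ℤ
        ≡⟨ ℤP.+-identityʳ ((N * x) ^ n) ⟩
      (N * x) ^ n ∎)
      where
      open ModReasoning P³
      x y t δ : ℤ
      x = + suc j
      y = P * c N * c x
      t = triangle n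
      δ = N * N - t
      cN : N * c N ≡ 1ℤ [mod P³ ]
      cN = c-inverse n N-coprime
      cx : x * c x ≡ 1ℤ [mod P³ ]
      cx = c-inverse (suc j) (coprime-< j j<p)
      y³≡0 : y * y * y ≡ 0ℤ [mod P³ ]
      y³≡0 = congruent (c N * c N * c N * (c x * c x * c x)) (lemma P (c N) (c x))
        where
        lemma : ∀ P a b → P * a * b * (P * a * b) * (P * a * b) ≡ 0ℤ + a * a * a * (b * b * b) * (P * P * P)
        lemma = solve-∀
      base : N * x + P ≡ N * x * (1ℤ + y) [mod P³ ]
      base = mod-trans (≡⇒≡mod (one (N * x) P)) (mod-trans (mod-+ˡ (N * x) (mod-*ˡ P (mod-sym (mod-* cN cx))))
        (≡⇒≡mod (factor N x P (c N) (c x))))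
        where
        one : ∀ a P → a + P ≡ a + P * (1ℤ * 1ℤ)
        one = solve-∀
        factor : ∀ N x P a b → N * x + P * (N * a * (x * b)) ≡ N * x * (1ℤ + P * a * b)
        factor = solve-∀
      first : -1ℤ * P * c x ≡ - (N * y) [mod P³ ]
      first = mod-trans (≡⇒≡mod (one P (c x))) (mod-trans (mod-*ˡ (-1ℤ * P * c x) (mod-sym cN))
        (≡⇒≡mod (factor N P (c N) (c x))))
        where
        one : ∀ P b → -1ℤ * P * b ≡ -1ℤ * P * b * 1ℤ
        one = solve-∀
        factor : ∀ N P a b → -1ℤ * P * b * (N * a) ≡ - (N * (P * a * b))
        factor = solve-∀
      second : ε * (P * P) * (c x * c x) ≡ δ * (y * y) [mod P³ ]
      second = mod-trans (≡⇒≡mod (one t (c N) P (c x))) (mod-trans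
        (mod-*ʳ (P * P * (c x * c x)) (mod-+ʳ (- (t * (c N * c N))) (mod-sym (mod-* cN cN))))
        (≡⇒≡mod (factor N t P (c N) (c x))))
        where
        one : ∀ t a P b → (1ℤ - t * (a * a)) * (P * P) * (b * b) ≡ (1ℤ * 1ℤ + - (t * (a * a))) * (P * P * (b * b))
        one = solve-∀
        factor : ∀ N t P a b → (N * a * (N * a) + - (t * (a * a))) * (P * P * (b * b))
          ≡ (N * N - t) * (P * a * b * (P * a * b))
        factor = solve-∀
      collect : ∀ A N y t → A * (1ℤ + N * y + t * (y * y)) * ((1ℤ + - (N * y)) * (1ℤ + (N * N - t) * (y * y)))
        ≡ A + A * (- (N * t) - (N * N - t) * (N * N - t) * y - N * t * (N * N - t) * (y * y)) * (y * y * y)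
      collect = solve-∀

    E : ℕ → ℤ
    E k = ∏< k (λ j → N * + suc j + P)

    -- Cross terms contain p⁴, so the product linearises modulo p³.
    ∏-ε : ∀ k → ∏< k (λ j → 1ℤ + ε * (P * P) * (c (+ suc j) * c (+ suc j))) ≡ 1ℤ + ε * (P * P) * H k [mod P³ ]
    ∏-ε zero    = ≡⇒≡mod (sym (cong (λ z → 1ℤ + z) (ℤP.*-zeroʳ (ε * (P * P)))))
    ∏-ε (suc k) = mod-trans (mod-*ʳ (1ℤ + ε * (P * P) * y) (∏-ε k))
      (congruent (ε * ε * P * H k * y) (lemma ε P (H k) y))
      where
      y = c (+ suc k) * c (+ suc k)
      lemma : ∀ e P h y → (1ℤ + e * (P * P) * h) * (1ℤ + e * (P * P) * y)
        ≡ 1ℤ + e * (P * P) * (h + y) + e * e * P * h * y * (P * P * P)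
      lemma = solve-∀

    ratio-expansion : ∀ k → k ℕ.< p →
      ∏< k (λ j → N * + suc j) ^ n ≡ E k ^ n * (alt p₁ k * (1ℤ + ε * (P * P) * H k)) [mod P³ ]
    ratio-expansion k k<p = begin
      ∏< k (λ j → N * + suc j) ^ n
        ≡⟨ ∏-^ n (λ j → N * + suc j) k ⟩
      ∏< k (λ j → (N * + suc j) ^ n)
        ≈⟨ ∏mod.fold-cong P³ k (λ j j<k → local-expansion j (ℕP.<-≤-trans (s≤s j<k) k<p)) ⟩
      ∏< k (λ j → (N * + suc j + P) ^ n * (f j * g j))
        ≡⟨ ∏.fold-∙ k (λ j → (N * + suc j + P) ^ n) (λ j → f j * g j) ⟩
      ∏< k (λ j → (N * + suc j + P) ^ n) * ∏< k (λ j → f j * g j)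
        ≡⟨ cong₂ _*_ (sym (∏-^ n (λ j → N * + suc j + P) k)) (∏.fold-∙ k f g) ⟩
      E k ^ n * (∏< k f * ∏< k g)
        ≈⟨ mod-*ˡ (E k ^ n) (mod-* (mod-sym (alt≡∏ k k<p)) (∏-ε k)) ⟩
      E k ^ n * (alt p₁ k * (1ℤ + ε * (P * P) * H k)) ∎
      where
      open ModReasoning P³
      f g : ℕ → ℤ
      f j = 1ℤ + -1ℤ * P * c (+ suc j)
      g j = 1ℤ + ε * (P * P) * (c (+ suc j) * c (+ suc j))

    u : ℤ
    u = ∏< r (λ j → N * + j + 1ℤ)

    u-factor : ∀ j → + suc (n ℕ.* j) ≡ N * + j + 1ℤ
    u-factor j = trans (ℤP.+-comm 1ℤ (+ (n ℕ.* j))) (cong (_+ 1ℤ) (ℤP.pos-* n j))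

    u-factor-coprime : ∀ j → j ℕ.< r → Coprime (+ suc (n ℕ.* j))
    u-factor-coprime j j<r = coprime-< (n ℕ.* j)
      (s≤s (subst (n ℕ.* j ℕ.<_) (trans (ℕP.*-comm n r) (sym p₁≡rn)) (ℕP.*-monoʳ-< n j<r)))

    u-invertible : Invertible P³ u
    u-invertible = inv-∏ r (λ j → N * + j + 1ℤ) λ j j<r →
      subst (Invertible P³) (u-factor j) (coprime-invertible (suc (n ℕ.* j)) (u-factor-coprime j j<r))

    E-invertible : ∀ k → k ℕ.< p → Invertible P³ (E k)
    E-invertible k k<p = inv-∏ k (λ j → N * + suc j + P) λ j j<k →
      subst (Invertible P³) (pos j) (coprime-invertible (n ℕ.* suc j ℕ.+ p)
        (coprime-mod (congruent 1ℤ (trans (pos j) (cong (λ z → N * + suc j + z) (sym (ℤP.*-identityˡ P)))))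
          (coprime-* N-coprime (coprime-< j (ℕP.<-≤-trans (s≤s j<k) k<p)))))
      where
      pos : ∀ j → + (n ℕ.* suc j ℕ.+ p) ≡ N * + suc j + P
      pos j = cong (_+ P) (ℤP.pos-* n (suc j))

    denominator-invertible : ∀ k → k ℕ.< p → Invertible P³ (u * E k)
    denominator-invertible k k<p = inv-* u-invertible (E-invertible k k<p)

    -- `z` is any integer representing aₖ modulo p³, known only through the relation with
    -- denominators cleared; E(k)ⁿ cancels as a unit.
    term-expansion : ∀ {z} k → k ℕ.< p → u * E k * z ≡ q k * ∏< k (λ j → N * + suc j) [mod P³ ] →
      u ^ n * z ^ n ≡ alt p₁ k * q k ^ n + ε * (P * P) * (alt p₁ k * (q k ^ n * H k)) [mod P³ ]
    term-expansion {z} k k<p e = inv-cancel (inv-^ n (E-invertible k k<p)) (begin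
      E k ^ n * (u ^ n * z ^ n)
        ≡⟨ trans (rearrange (E k ^ n) (u ^ n) (z ^ n)) (sym (trans (*-^ (u * E k) z n) (cong (_* z ^ n) (*-^ u (E k) n)))) ⟩
      (u * E k * z) ^ n
        ≈⟨ mod-^ n e ⟩
      (q k * ∏< k (λ j → N * + suc j)) ^ n
        ≡⟨ *-^ (q k) (∏< k (λ j → N * + suc j)) n ⟩
      q k ^ n * ∏< k (λ j → N * + suc j) ^ n
        ≈⟨ mod-*ˡ (q k ^ n) (ratio-expansion k k<p) ⟩
      q k ^ n * (E k ^ n * (alt p₁ k * (1ℤ + ε * (P * P) * H k)))
        ≡⟨ expand (q k ^ n) (E k ^ n) (alt p₁ k) (ε * (P * P)) (H k) ⟩
      E k ^ n * (alt p₁ k * q k ^ n + ε * (P * P) * (alt p₁ k * (q k ^ n * H k))) ∎)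
      where
      open ModReasoning P³
      rearrange : ∀ e u z → e * (u * z) ≡ u * e * z
      rearrange = solve-∀
      expand : ∀ q e a d h → q * (e * (a * (1ℤ + d * h))) ≡ e * (a * q + d * (a * (q * h)))
      expand = solve-∀

    ∑-alt-qⁿ : ∑< p (λ k → alt p₁ k * q k ^ n) ≡ N^p₁ * fact p₁
    ∑-alt-qⁿ = begin
      ∑< p (λ k → alt p₁ k * q k ^ n)  ≡⟨ twist-∑ -1ℤ p₁ (λ k → q k ^ n) 0 ⟨
      ∇ p₁ (λ k → q k ^ n) 0
        ≡⟨ subst (λ d → Leading N d 1ℤ (λ k → q k ^ n)) (sym p₁≡rn) (leading-∏^ {N} (λ i → N * + suc i + 1ℤ) n r) 0 ⟩
      1ℤ * (- N) ^ p₁ * fact p₁        ≡⟨ cong (_* fact p₁) (trans (ℤP.*-identityˡ ((- N) ^ p₁)) -N^p₁) ⟩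
      N^p₁ * fact p₁                   ∎
      where open ≡-Reasoning

    ∑-expansion : ∀ (z : ℕ → ℤ) → (∀ k → k ℕ.< p → u * E k * z k ≡ q k * ∏< k (λ j → N * + suc j) [mod P³ ]) →
      u ^ n * ∑< p (λ k → z k ^ n) ≡ N^p₁ * fact p₁ [mod P³ ]
    ∑-expansion z e = begin
      u ^ n * ∑< p (λ k → z k ^ n)
        ≡⟨ ∑-*ˡ (u ^ n) p (λ k → z k ^ n) ⟩
      ∑< p (λ k → u ^ n * z k ^ n)
        ≈⟨ ∑mod.fold-cong P³ p (λ k k<p → term-expansion {z k} k k<p (e k k<p)) ⟩
      ∑< p (λ k → alt p₁ k * q k ^ n + ε * (P * P) * (alt p₁ k * qⁿH k))
        ≡⟨ ∑.fold-∙ p (λ k → alt p₁ k * q k ^ n) (λ k → ε * (P * P) * (alt p₁ k * qⁿH k)) ⟩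
      ∑< p (λ k → alt p₁ k * q k ^ n) + ∑< p (λ k → ε * (P * P) * (alt p₁ k * qⁿH k))
        ≡⟨ cong₂ _+_ ∑-alt-qⁿ (trans (sym (∑-*ˡ (ε * (P * P)) p (λ k → alt p₁ k * qⁿH k)))
             (ℤP.*-assoc ε (P * P) (∑< p (λ k → alt p₁ k * qⁿH k)))) ⟩
      N^p₁ * fact p₁ + ε * (P * P * ∑< p (λ k → alt p₁ k * qⁿH k))
        ≈⟨ mod-+ˡ (N^p₁ * fact p₁) (mod-≡0-* ε (mod-trans (mod-scale (P * P) vanish) (≡⇒≡mod (ℤP.*-zeroʳ (P * P))))) ⟩
      N^p₁ * fact p₁ + 0ℤ
        ≡⟨ ℤP.+-identityʳ (N^p₁ * fact p₁) ⟩
      N^p₁ * fact p₁ ∎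
      where
      open ModReasoning P³
      -- The prefactor p² leaves only residues modulo p to control, where the weights `alt` are 1.
      vanish : ∑< p (λ k → alt p₁ k * qⁿH k) ≡ 0ℤ [mod P ]
      vanish = mod-trans (∑mod.fold-cong P p λ k k<p →
        mod-trans (mod-*ʳ (qⁿH k) (alt≡1 k k<p)) (≡⇒≡mod (ℤP.*-identityˡ (qⁿH k)))) ∑qⁿH≡0

  -- Morita's Gamma function at a representative of 1/n

  powℤ≡^ : ∀ x m → powℤ x m ≡ x ^ m
  powℤ≡^ x zero    = refl
  powℤ≡^ x (suc m) = cong (x *_) (powℤ≡^ x m)

  -1^-square : ∀ m → -1ℤ ^ m * -1ℤ ^ m ≡ 1ℤ
  -1^-square m = trans (sym (*-^ -1ℤ -1ℤ m)) (ℤP.^-zeroˡ m)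

  module Gamma (s : ℕ) (prime : Prime (4 ℕ.+ s)) (n₃ r : ℕ) (p₁≡rn : 3 ℕ.+ s ≡ r ℕ.* (3 ℕ.+ n₃)) where
    open Expansion s prime n₃ r p₁≡rn public

    coprimePart : ℕ → ℤ
    coprimePart j = if ⌊ p ∣? j ⌋ then 1ℤ else + j

    coprimePart-∣ : ∀ {j} → p ∣ j → coprimePart j ≡ 1ℤ
    coprimePart-∣ {j} d with p ∣? j
    ... | yes _ = refl
    ... | no ¬d = ⊥-elim (¬d d)

    coprimePart-coprime : ∀ {j} → Coprime (+ j) → coprimePart j ≡ + j
    coprimePart-coprime {j} c with p ∣? j
    ... | yes d = ⊥-elim (c (∣⇒≡0 d))
    ... | no _  = refl

    opaque

      pc : ℕ → ℤ
      pc = prodCoprime p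

      pc-unfold : ∀ m → pc m ≡ prodCoprime p m
      pc-unfold m = refl

      pc-zero : pc 0 ≡ 1ℤ
      pc-zero = refl

      -- At m = 0 the factor is 1 because p divides 0, so one recursion covers both base clauses of
      -- `prodCoprime`.
      pc-suc : ∀ m → pc (suc m) ≡ pc m * coprimePart m
      pc-suc zero    = sym (trans (ℤP.*-identityˡ (coprimePart 0)) (coprimePart-∣ (p ∣0)))
      pc-suc (suc m) = refl

    pc-+ : ∀ m k → pc (m ℕ.+ k) ≡ pc m * ∏< k (λ j → coprimePart (m ℕ.+ j))
    pc-+ m zero    = trans (cong pc (ℕP.+-identityʳ m)) (sym (ℤP.*-identityʳ (pc m)))
    pc-+ m (suc k) = begin
      pc (m ℕ.+ suc k)                                     ≡⟨ cong pc (ℕP.+-suc m k) ⟩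
      pc (suc (m ℕ.+ k))                                   ≡⟨ pc-suc (m ℕ.+ k) ⟩
      pc (m ℕ.+ k) * g k                                   ≡⟨ cong (_* g k) (pc-+ m k) ⟩
      pc m * ∏< k g * g k                                  ≡⟨ ℤP.*-assoc (pc m) (∏< k g) (g k) ⟩
      pc m * ∏< (suc k) g                                  ∎
      where
      open ≡-Reasoning
      g : ℕ → ℤ
      g j = coprimePart (m ℕ.+ j)

    -- In a block of p integers starting at a multiple of p, the first contributes 1 and the others
    -- form the product in `wolstenholme`.
    pc-multiple : ∀ M → pc (M ℕ.* p) ≡ fact p₁ ^ M [mod P³ ]
    pc-multiple zero    = ≡⇒≡mod pc-zero
    pc-multiple (suc M) = begin
      pc (p ℕ.+ M ℕ.* p)
        ≡⟨ cong pc (ℕP.+-comm p (M ℕ.* p)) ⟩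
      pc (M ℕ.* p ℕ.+ p)
        ≡⟨ pc-+ (M ℕ.* p) p ⟩
      pc (M ℕ.* p) * ∏< p g
        ≡⟨ cong (pc (M ℕ.* p) *_) (trans (∏.fold-head p₁ g)
             (trans (cong₂ _*_ (coprimePart-∣ (divides M (ℕP.+-identityʳ (M ℕ.* p)))) (∏.fold-cong p₁ block))
               (ℤP.*-identityˡ (∏< p₁ (λ j → + suc j + + M * P))))) ⟩
      pc (M ℕ.* p) * ∏< p₁ (λ j → + suc j + + M * P)
        ≈⟨ mod-* (pc-multiple M) (wolstenholme (+ M)) ⟩
      fact p₁ ^ M * fact p₁
        ≡⟨ ℤP.*-comm (fact p₁ ^ M) (fact p₁) ⟩
      fact p₁ ^ suc M ∎
      where
      open ModReasoning P³
      g : ℕ → ℤ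
      g j = coprimePart (M ℕ.* p ℕ.+ j)
      value : ∀ j → + (M ℕ.* p ℕ.+ suc j) ≡ + suc j + + M * P
      value j = trans (cong +_ (ℕP.+-comm (M ℕ.* p) (suc j))) (cong (λ z → + suc j + z) (ℤP.pos-* M p))
      block : ∀ j → j ℕ.< p₁ → g (suc j) ≡ + suc j + + M * P
      block j j<p₁ = trans (coprimePart-coprime (coprime-mod (congruent (+ M) (value j)) (coprime-< j (s≤s j<p₁)))) (value j)

    P³≡ : + (p ℕ.^ 3) ≡ P³
    P³≡ = begin
      + (p ℕ.* (p ℕ.* (p ℕ.* 1)))  ≡⟨ ℤP.pos-* p (p ℕ.* (p ℕ.* 1)) ⟩
      P * + (p ℕ.* (p ℕ.* 1))      ≡⟨ cong (P *_) (ℤP.pos-* p (p ℕ.* 1)) ⟩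
      P * (P * + (p ℕ.* 1))        ≡⟨ cong (λ z → P * (P * + z)) (ℕP.*-identityʳ p) ⟩
      P * (P * P)                  ≡⟨ ℤP.*-assoc P P P ⟨
      P * P * P                    ∎
      where open ≡-Reasoning

    -- `X` represents 1/n modulo p³, and `t` records the exact quotient, which later enters an
    -- exponent.
    module _ (X t : ℕ) (NX : N * + X ≡ 1ℤ + + t * P³) where

      N[X+r] : N * (+ X + + r) ≡ (1ℤ + + t * (P * P)) * P
      N[X+r] = begin
        N * (+ X + + r)                      ≡⟨ split N (+ X) (+ r) ⟩
        N * + X + (N * + r + 1ℤ) - 1ℤ        ≡⟨ cong₂ (λ a b → a + b - 1ℤ) NX Nr+1 ⟩
        1ℤ + + t * (P * P * P) + P - 1ℤ      ≡⟨ factor (+ t) P ⟩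
        (1ℤ + + t * (P * P)) * P             ∎
        where
        open ≡-Reasoning
        split : ∀ N X r → N * (X + r) ≡ N * X + (N * r + 1ℤ) - 1ℤ
        split = solve-∀
        factor : ∀ t P → 1ℤ + t * (P * P * P) + P - 1ℤ ≡ (1ℤ + t * (P * P)) * P
        factor = solve-∀

      p∣X+r : p ∣ X ℕ.+ r
      p∣X+r = ≡0⇒∣ {p} {+ (X ℕ.+ r)} (coprime-cancel {N} {+ X + + r} {0ℤ} N-coprime
        (mod-trans (congruent (1ℤ + + t * (P * P)) (trans N[X+r] (sym (ℤP.+-identityˡ _))))
          (≡⇒≡mod (sym (ℤP.*-zeroʳ N)))))

      M : ℕ
      M = ℕD.quotient p∣X+r

      X+r≡Mp : X ℕ.+ r ≡ M ℕ.* p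
      X+r≡Mp = ℕD._∣_.equality p∣X+r

      -- Kept as an exact equation of natural numbers, since n·M is used as an exponent.
      nM : n ℕ.* M ≡ 1 ℕ.+ (p ℕ.* p) ℕ.* t
      nM = ℤP.+-injective (ℤP.*-cancelʳ-≡ (+ (n ℕ.* M)) (+ (1 ℕ.+ (p ℕ.* p) ℕ.* t)) P (begin
        + (n ℕ.* M) * P               ≡⟨ cong (_* P) (ℤP.pos-* n M) ⟩
        N * + M * P                   ≡⟨ ℤP.*-assoc N (+ M) P ⟩
        N * (+ M * P)                 ≡⟨ cong (N *_) (ℤP.pos-* M p) ⟨
        N * + (M ℕ.* p)               ≡⟨ cong (λ z → N * + z) X+r≡Mp ⟨
        N * (+ X + + r)               ≡⟨ N[X+r] ⟩
        (1ℤ + + t * (P * P)) * P      ≡⟨ cong (λ z → (1ℤ + z) * P)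
          (trans (ℤP.*-comm (+ t) (P * P)) (trans (cong (_* + t) (sym (ℤP.pos-* p p))) (sym (ℤP.pos-* (p ℕ.* p) t)))) ⟩
        + (1 ℕ.+ (p ℕ.* p) ℕ.* t) * P ∎))
        where open ≡-Reasoning

      N[X+j] : ∀ j → N * + (X ℕ.+ j) ≡ N * + j + 1ℤ [mod P³ ]
      N[X+j] j = congruent (+ t) (trans (ℤP.*-distribˡ-+ N (+ X) (+ j))
        (trans (cong (_+ N * + j) NX) (rotate (+ t * P³) (N * + j))))
        where
        rotate : ∀ a b → 1ℤ + a + b ≡ b + 1ℤ + a
        rotate = solve-∀

      coprime-X+j : ∀ j → j ℕ.< r → Coprime (+ (X ℕ.+ j))
      coprime-X+j j j<r e = u-factor-coprime j j<r
        (mod-trans (≡⇒≡mod (u-factor j)) (mod-trans (mod-sym (mod-weaken (P * P) (N[X+j] j))) (mod-≡0-* N e)))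

      -- The functional equation is applied r times, from X to X + r = Mp. No multiple of p is
      -- passed on the way, and n^r turns the factors X + j into nj + 1.
      pc-X+r : N ^ r * pc (M ℕ.* p) ≡ u * pc X [mod P³ ]
      pc-X+r = begin
        N ^ r * pc (M ℕ.* p)
          ≡⟨ cong₂ _*_ (sym (∏-const N r)) (trans (cong pc (sym X+r≡Mp)) (pc-+ X r)) ⟩
        ∏< r (λ _ → N) * (pc X * ∏< r (λ j → coprimePart (X ℕ.+ j)))
          ≡⟨ cong (λ z → ∏< r (λ _ → N) * (pc X * z)) (∏.fold-cong r (λ j j<r → coprimePart-coprime (coprime-X+j j j<r))) ⟩
        ∏< r (λ _ → N) * (pc X * ∏< r (λ j → + (X ℕ.+ j)))
          ≡⟨ rearrange (∏< r (λ _ → N)) (pc X) (∏< r (λ j → + (X ℕ.+ j))) ⟩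
        ∏< r (λ _ → N) * ∏< r (λ j → + (X ℕ.+ j)) * pc X
          ≡⟨ cong (_* pc X) (∏.fold-∙ r (λ _ → N) (λ j → + (X ℕ.+ j))) ⟨
        ∏< r (λ j → N * + (X ℕ.+ j)) * pc X
          ≈⟨ mod-*ʳ (pc X) (∏mod.fold-cong P³ r (λ j _ → N[X+j] j)) ⟩
        u * pc X ∎
        where
        open ModReasoning P³
        rearrange : ∀ a b c → a * (b * c) ≡ a * c * b
        rearrange = solve-∀

      -- By Wilson -(p - 1)! is 1 modulo p, so the exponent 1 + p²t leaves a single factor modulo
      -- p³; the sign is split off first.
      fact-power : fact p₁ ^ (n ℕ.* M) ≡ -1ℤ ^ (n ℕ.* M) * - fact p₁ [mod P³ ]
      fact-power = begin
        w ^ (n ℕ.* M)                               ≡⟨ cong (_^ (n ℕ.* M)) (double-neg w) ⟩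
        (-1ℤ * - w) ^ (n ℕ.* M)                     ≡⟨ *-^ -1ℤ (- w) (n ℕ.* M) ⟩
        -1ℤ ^ (n ℕ.* M) * (- w) ^ (n ℕ.* M)         ≡⟨ cong (λ m → -1ℤ ^ (n ℕ.* M) * (- w) ^ m) nM ⟩
        -1ℤ ^ (n ℕ.* M) * (- w * (- w) ^ ((p ℕ.* p) ℕ.* t))
          ≈⟨ mod-*ˡ (-1ℤ ^ (n ℕ.* M)) (mod-*ˡ (- w) (mod-trans (≡⇒≡mod (sym (ℤP.^-*-assoc (- w) (p ℕ.* p) t)))
               (mod-trans (mod-^ t (^p²≡1 (mod-neg wilson))) (≡⇒≡mod (ℤP.^-zeroˡ t))))) ⟩
        -1ℤ ^ (n ℕ.* M) * (- w * 1ℤ)                ≡⟨ cong (-1ℤ ^ (n ℕ.* M) *_) (ℤP.*-identityʳ (- w)) ⟩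
        -1ℤ ^ (n ℕ.* M) * - w                       ∎
        where
        open ModReasoning P³
        w = fact p₁
        double-neg : ∀ w → w ≡ -1ℤ * - w
        double-neg = solve-∀

      -- Multiplying by (-1)^(rn) = 1 replaces X by X + r = pM, and p is odd.
      sign-X : (-1ℤ ^ X) ^ n ≡ -1ℤ ^ (n ℕ.* M)
      sign-X = begin
        (-1ℤ ^ X) ^ n                        ≡⟨ ℤP.*-identityʳ _ ⟨
        (-1ℤ ^ X) ^ n * 1ℤ
          ≡⟨ cong ((-1ℤ ^ X) ^ n *_) (trans (ℤP.^-*-assoc -1ℤ r n) (trans (cong (-1ℤ ^_) (sym p₁≡rn)) even-sign)) ⟨
        (-1ℤ ^ X) ^ n * (-1ℤ ^ r) ^ n        ≡⟨ *-^ (-1ℤ ^ X) (-1ℤ ^ r) n ⟨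
        (-1ℤ ^ X * -1ℤ ^ r) ^ n              ≡⟨ cong (_^ n) (ℤP.^-distribˡ-+-* -1ℤ X r) ⟨
        (-1ℤ ^ (X ℕ.+ r)) ^ n                ≡⟨ cong (λ m → (-1ℤ ^ m) ^ n) (trans X+r≡Mp (ℕP.*-comm M p)) ⟩
        (-1ℤ ^ (p ℕ.* M)) ^ n                ≡⟨ cong (_^ n) (ℤP.^-*-assoc -1ℤ p M) ⟨
        ((-1ℤ ^ p) ^ M) ^ n                  ≡⟨ cong (λ z → (z ^ M) ^ n) (cong (-1ℤ *_) even-sign) ⟩
        (-1ℤ ^ M) ^ n                        ≡⟨ ℤP.^-*-assoc -1ℤ M n ⟩
        -1ℤ ^ (M ℕ.* n)                      ≡⟨ cong (-1ℤ ^_) (ℕP.*-comm M n) ⟩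
        -1ℤ ^ (n ℕ.* M)                      ∎
        where open ≡-Reasoning

      Γ-power : u ^ n * powℤ (Γp-nat p X) n ≡ - (N^p₁ * fact p₁) [mod P³ ]
      Γ-power = begin
        u ^ n * powℤ (Γp-nat p X) n
          ≡⟨ cong (u ^ n *_) (powℤ≡^ (Γp-nat p X) n) ⟩
        u ^ n * Γp-nat p X ^ n
          ≡⟨ cong (λ z → u ^ n * z ^ n) (cong₂ _*_ (powℤ≡^ -1ℤ X) (sym (pc-unfold X))) ⟩
        u ^ n * (-1ℤ ^ X * pc X) ^ n
          ≡⟨ cong (u ^ n *_) (trans (*-^ (-1ℤ ^ X) (pc X) n) (cong (_* pc X ^ n) sign-X)) ⟩
        u ^ n * (σ * pc X ^ n)
          ≡⟨ swap (u ^ n) σ (pc X ^ n) ⟩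
        σ * (u ^ n * pc X ^ n)
          ≡⟨ cong (σ *_) (*-^ u (pc X) n) ⟨
        σ * (u * pc X) ^ n
          ≈⟨ mod-*ˡ σ (mod-^ n pc-X+r) ⟨
        σ * (N ^ r * pc (M ℕ.* p)) ^ n
          ≈⟨ mod-*ˡ σ (mod-^ n (mod-*ˡ (N ^ r) (pc-multiple M))) ⟩
        σ * (N ^ r * fact p₁ ^ M) ^ n
          ≡⟨ cong (σ *_) (*-^ (N ^ r) (fact p₁ ^ M) n) ⟩
        σ * ((N ^ r) ^ n * (fact p₁ ^ M) ^ n)
          ≡⟨ cong (σ *_) (cong₂ _*_ (trans (ℤP.^-*-assoc N r n) (cong (N ^_) (sym p₁≡rn)))
               (trans (ℤP.^-*-assoc (fact p₁) M n) (cong (fact p₁ ^_) (ℕP.*-comm M n)))) ⟩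
        σ * (N^p₁ * fact p₁ ^ (n ℕ.* M))
          ≈⟨ mod-*ˡ σ (mod-*ˡ N^p₁ fact-power) ⟩
        σ * (N^p₁ * (σ * - fact p₁))
          -- The sign of `Γp-nat` and that of `fact-power` agree, so together they square to 1.
          ≡⟨ collect σ N^p₁ (fact p₁) ⟩
        σ * σ * - (N^p₁ * fact p₁)
          ≡⟨ cong (_* - (N^p₁ * fact p₁)) (-1^-square (n ℕ.* M)) ⟩
        1ℤ * - (N^p₁ * fact p₁)
          ≡⟨ ℤP.*-identityˡ (- (N^p₁ * fact p₁)) ⟩
        - (N^p₁ * fact p₁) ∎
        where
        open ModReasoning P³
        σ = -1ℤ ^ (n ℕ.* M)
        swap : ∀ a b c → a * (b * c) ≡ b * (a * c)
        swap = solve-∀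
        collect : ∀ σ a w → σ * (a * (σ * - w)) ≡ σ * σ * - (a * w)
        collect = solve-∀

  -- Integers inside the rationals

  ℚ-ring : AlmostCommutativeRing 0ℓ 0ℓ
  ℚ-ring = fromCommutativeRing ℚP.+-*-commutativeRing (λ _ → nothing)

  -- Agrees by computation with `ι` on natural numbers and with the integer side of `_≡ℚ_[mod_]`.
  ιℤ : ℤ → ℚ
  ιℤ z = z ℚ./ 1

  toℚᵘ-ιℤ : ∀ z → ℚ.toℚᵘ (ιℤ z) ℚᵘ.≃ ℚᵘ.mkℚᵘ z 0
  toℚᵘ-ιℤ z = ℚP.toℚᵘ-fromℚᵘ (ℚᵘ.mkℚᵘ z 0)

  ιℤ-+ : ∀ x y → ιℤ (x + y) ≡ ιℤ x ℚ.+ ιℤ y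
  ιℤ-+ x y = ℚP.toℚᵘ-injective (begin
    ℚ.toℚᵘ (ιℤ (x + y))                      ≈⟨ toℚᵘ-ιℤ (x + y) ⟩
    ℚᵘ.mkℚᵘ (x + y) 0                        ≈⟨ ℚᵘ.*≡* (lemma x y) ⟩
    ℚᵘ.mkℚᵘ x 0 ℚᵘ.+ ℚᵘ.mkℚᵘ y 0             ≈⟨ ℚᵘP.+-cong (toℚᵘ-ιℤ x) (toℚᵘ-ιℤ y) ⟨
    ℚ.toℚᵘ (ιℤ x) ℚᵘ.+ ℚ.toℚᵘ (ιℤ y)         ≈⟨ ℚP.toℚᵘ-homo-+ (ιℤ x) (ιℤ y) ⟨
    ℚ.toℚᵘ (ιℤ x ℚ.+ ιℤ y)                   ∎)
    where
    open import Relation.Binary.Reasoning.Setoid ℚᵘP.≃-setoid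
    lemma : ∀ x y → (x + y) * (1ℤ * 1ℤ) ≡ (x * 1ℤ + y * 1ℤ) * 1ℤ
    lemma = solve-∀

  ιℤ-* : ∀ x y → ιℤ (x * y) ≡ ιℤ x ℚ.* ιℤ y
  ιℤ-* x y = ℚP.toℚᵘ-injective (begin
    ℚ.toℚᵘ (ιℤ (x * y))                      ≈⟨ toℚᵘ-ιℤ (x * y) ⟩
    ℚᵘ.mkℚᵘ x 0 ℚᵘ.* ℚᵘ.mkℚᵘ y 0             ≈⟨ ℚᵘP.*-cong (toℚᵘ-ιℤ x) (toℚᵘ-ιℤ y) ⟨
    ℚ.toℚᵘ (ιℤ x) ℚᵘ.* ℚ.toℚᵘ (ιℤ y)         ≈⟨ ℚP.toℚᵘ-homo-* (ιℤ x) (ιℤ y) ⟨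
    ℚ.toℚᵘ (ιℤ x ℚ.* ιℤ y)                   ∎)
    where open import Relation.Binary.Reasoning.Setoid ℚᵘP.≃-setoid

  ιℤ-neg : ∀ x → ιℤ (- x) ≡ ℚ.- ιℤ x
  ιℤ-neg x = begin
    ιℤ (- x)                             ≡⟨ ℚP.+-identityʳ (ιℤ (- x)) ⟨
    ιℤ (- x) ℚ.+ 0ℚ                      ≡⟨ cong (ιℤ (- x) ℚ.+_) (ℚP.+-inverseʳ (ιℤ x)) ⟨
    ιℤ (- x) ℚ.+ (ιℤ x ℚ.- ιℤ x)         ≡⟨ ℚP.+-assoc (ιℤ (- x)) (ιℤ x) (ℚ.- ιℤ x) ⟨
    ιℤ (- x) ℚ.+ ιℤ x ℚ.- ιℤ x           ≡⟨ cong (ℚ._- ιℤ x) (trans (sym (ιℤ-+ (- x) x)) (cong ιℤ (ℤP.+-inverseˡ x))) ⟩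
    0ℚ ℚ.- ιℤ x                          ≡⟨ ℚP.+-identityˡ (ℚ.- ιℤ x) ⟩
    ℚ.- ιℤ x                             ∎
    where open ≡-Reasoning

  -- Links an equation in ℚ to the reduced numerator and denominator, in terms of which the final
  -- congruence is stated.
  ιℤ-scale : ∀ d x y → ιℤ d ℚ.* x ≡ ιℤ y → d * ↥ x ≡ y * ↧ x
  ιℤ-scale d x@record{} y e with begin
    ℚᵘ.mkℚᵘ d 0 ℚᵘ.* ℚ.toℚᵘ x               ≈⟨ ℚᵘP.*-congʳ {ℚ.toℚᵘ x} (toℚᵘ-ιℤ d) ⟨
    ℚ.toℚᵘ (ιℤ d) ℚᵘ.* ℚ.toℚᵘ x             ≈⟨ ℚP.toℚᵘ-homo-* (ιℤ d) x ⟨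
    ℚ.toℚᵘ (ιℤ d ℚ.* x)                     ≡⟨ cong ℚ.toℚᵘ e ⟩
    ℚ.toℚᵘ (ιℤ y)                           ≈⟨ toℚᵘ-ιℤ y ⟩
    ℚᵘ.mkℚᵘ y 0                             ∎
    where open import Relation.Binary.Reasoning.Setoid ℚᵘP.≃-setoid
  ... | ℚᵘ.*≡* eq = trans (sym (ℤP.*-identityʳ (d * ↥ x))) (trans eq (cong (y *_) (ℤP.*-identityˡ (↧ x))))

  ιℤ-injective : ∀ {x y} → ιℤ x ≡ ιℤ y → x ≡ y
  ιℤ-injective {x} {y} e = trans (sym (ℤP.*-identityʳ x)) (trans
    (ιℤ-scale x 1ℚ y (trans (ℚP.*-identityʳ (ιℤ x)) e)) (ℤP.*-identityʳ y))

  ιℤ-frac : ∀ a d → ιℤ (+ suc d) ℚ.* frac a (suc d) ≡ ιℤ (+ a)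
  ιℤ-frac a d = ℚP.toℚᵘ-injective (begin
    ℚ.toℚᵘ (ιℤ (+ suc d) ℚ.* frac a (suc d))             ≈⟨ ℚP.toℚᵘ-homo-* (ιℤ (+ suc d)) (frac a (suc d)) ⟩
    ℚ.toℚᵘ (ιℤ (+ suc d)) ℚᵘ.* ℚ.toℚᵘ (frac a (suc d))
      ≈⟨ ℚᵘP.*-cong (toℚᵘ-ιℤ (+ suc d)) (ℚP.toℚᵘ-fromℚᵘ (ℚᵘ.mkℚᵘ (+ a) d)) ⟩
    ℚᵘ.mkℚᵘ (+ suc d) 0 ℚᵘ.* ℚᵘ.mkℚᵘ (+ a) d             ≈⟨ ℚᵘ.*≡* (lemma (+ suc d) (+ a)) ⟩
    ℚᵘ.mkℚᵘ (+ a) 0                                      ≈⟨ toℚᵘ-ιℤ (+ a) ⟨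
    ℚ.toℚᵘ (ιℤ (+ a))                                    ∎)
    where
    open import Relation.Binary.Reasoning.Setoid ℚᵘP.≃-setoid
    lemma : ∀ s a → s * a * 1ℤ ≡ a * (1ℤ * s)
    lemma = solve-∀

  inv-right : ∀ {x} → x ≢ 0ℚ → x ℚ.* inv x ≡ 1ℚ
  inv-right {x} x≢0 with x ℚP.≟ 0ℚ
  ... | yes e  = ⊥-elim (x≢0 e)
  ... | no x≢0′ = ℚP.*-inverseʳ x {{ℚ.≢-nonZero x≢0′}}

  ℚ-cancel : ∀ {x y z} → z ≢ 0ℚ → x ℚ.* z ≡ y ℚ.* z → x ≡ y
  ℚ-cancel {x} {y} {z} z≢0 e = begin
    x                        ≡⟨ ℚP.*-identityʳ x ⟨
    x ℚ.* 1ℚ                 ≡⟨ cong (x ℚ.*_) (inv-right z≢0) ⟨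
    x ℚ.* (z ℚ.* inv z)      ≡⟨ ℚP.*-assoc x z (inv z) ⟨
    x ℚ.* z ℚ.* inv z        ≡⟨ cong (ℚ._* inv z) e ⟩
    y ℚ.* z ℚ.* inv z        ≡⟨ ℚP.*-assoc y z (inv z) ⟩
    y ℚ.* (z ℚ.* inv z)      ≡⟨ cong (y ℚ.*_) (inv-right z≢0) ⟩
    y ℚ.* 1ℚ                 ≡⟨ ℚP.*-identityʳ y ⟩
    y                        ∎
    where open ≡-Reasoning

  powℚ-* : ∀ x y m → powℚ (x ℚ.* y) m ≡ powℚ x m ℚ.* powℚ y m
  powℚ-* x y zero    = sym (ℚP.*-identityˡ 1ℚ)
  powℚ-* x y (suc m) = trans (cong (x ℚ.* y ℚ.*_) (powℚ-* x y m)) (lemma x y (powℚ x m) (powℚ y m))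
    where
    lemma : ∀ x y a b → x ℚ.* y ℚ.* (a ℚ.* b) ≡ x ℚ.* a ℚ.* (y ℚ.* b)
    lemma = solveℚ ℚ-ring

  powℚ-1 : ∀ m → powℚ 1ℚ m ≡ 1ℚ
  powℚ-1 zero    = refl
  powℚ-1 (suc m) = trans (ℚP.*-identityˡ (powℚ 1ℚ m)) (powℚ-1 m)

  powℚ-inv : ∀ {x} → x ≢ 0ℚ → ∀ m → powℚ x m ℚ.* powℚ (inv x) m ≡ 1ℚ
  powℚ-inv {x} x≢0 m = trans (sym (powℚ-* x (inv x) m)) (trans (cong (λ y → powℚ y m) (inv-right x≢0)) (powℚ-1 m))

  unit≢0 : ∀ {x y} → x ℚ.* y ≡ 1ℚ → x ≢ 0ℚ
  unit≢0 {y = y} e refl with trans (sym e) (ℚP.*-zeroˡ y)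
  ... | ()

  -- With `powℚ-inv` this identifies the reciprocal of a power with the power of the reciprocal.
  inv-unique : ∀ {x y} → x ℚ.* y ≡ 1ℚ → inv x ≡ y
  inv-unique {x} {y} e = ℚ-cancel (unit≢0 {x} {y} e) (trans (ℚP.*-comm (inv x) x)
    (trans (inv-right {x} (unit≢0 {x} {y} e)) (trans (sym e) (ℚP.*-comm x y))))

  -- Rational numbers congruent to integers

  -- Any denominator that is a unit modulo m is allowed, not just the reduced one, so sums and
  -- products need no gcd.
  record _≃_[modℚ_] (x : ℚ) (z m : ℤ) : Set where
    constructor congruentℚ
    field
      {denominator numerator} : ℤ
      unit : Invertible m denominator
      scaled : ιℤ denominator ℚ.* x ≡ ιℤ numerator
      congruence : numerator ≡ denominator * z [mod m ]

  infix 4 _≃_[modℚ_]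

  module _ {m : ℤ} where

    modℚ-+ : ∀ {x y z w} → x ≃ z [modℚ m ] → y ≃ w [modℚ m ] → x ℚ.+ y ≃ z + w [modℚ m ]
    modℚ-+ {x} {y} {z} {w} (congruentℚ {d} {a} i e h) (congruentℚ {d′} {a′} i′ e′ h′) =
      congruentℚ {numerator = a * d′ + d * a′} (inv-* i i′) scaled
        (mod-trans (mod-+ (mod-*ʳ d′ h) (mod-*ˡ d h′)) (≡⇒≡mod (distribute d d′ z w)))
      where
      open ≡-Reasoning
      expand : ∀ d d′ x y → d ℚ.* d′ ℚ.* (x ℚ.+ y) ≡ d ℚ.* x ℚ.* d′ ℚ.+ d ℚ.* (d′ ℚ.* y)
      expand = solveℚ ℚ-ring
      distribute : ∀ d d′ z w → d * z * d′ + d * (d′ * w) ≡ d * d′ * (z + w)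
      distribute = solve-∀
      scaled : ιℤ (d * d′) ℚ.* (x ℚ.+ y) ≡ ιℤ (a * d′ + d * a′)
      scaled = begin
        ιℤ (d * d′) ℚ.* (x ℚ.+ y)                            ≡⟨ cong (ℚ._* (x ℚ.+ y)) (ιℤ-* d d′) ⟩
        ιℤ d ℚ.* ιℤ d′ ℚ.* (x ℚ.+ y)                         ≡⟨ expand (ιℤ d) (ιℤ d′) x y ⟩
        ιℤ d ℚ.* x ℚ.* ιℤ d′ ℚ.+ ιℤ d ℚ.* (ιℤ d′ ℚ.* y)
          ≡⟨ cong₂ (λ p q → p ℚ.* ιℤ d′ ℚ.+ ιℤ d ℚ.* q) e e′ ⟩
        ιℤ a ℚ.* ιℤ d′ ℚ.+ ιℤ d ℚ.* ιℤ a′                    ≡⟨ cong₂ ℚ._+_ (ιℤ-* a d′) (ιℤ-* d a′) ⟨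
        ιℤ (a * d′) ℚ.+ ιℤ (d * a′)                          ≡⟨ ιℤ-+ (a * d′) (d * a′) ⟨
        ιℤ (a * d′ + d * a′)                                 ∎

    modℚ-* : ∀ {x y z w} → x ≃ z [modℚ m ] → y ≃ w [modℚ m ] → x ℚ.* y ≃ z * w [modℚ m ]
    modℚ-* {x} {y} {z} {w} (congruentℚ {d} {a} i e h) (congruentℚ {d′} {a′} i′ e′ h′) =
      congruentℚ {numerator = a * a′} (inv-* i i′) scaled
        (mod-trans (mod-* h h′) (≡⇒≡mod (rearrangeℤ d d′ z w)))
      where
      open ≡-Reasoning
      rearrange : ∀ d d′ x y → d ℚ.* d′ ℚ.* (x ℚ.* y) ≡ d ℚ.* x ℚ.* (d′ ℚ.* y)
      rearrange = solveℚ ℚ-ring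
      rearrangeℤ : ∀ d d′ z w → d * z * (d′ * w) ≡ d * d′ * (z * w)
      rearrangeℤ = solve-∀
      scaled : ιℤ (d * d′) ℚ.* (x ℚ.* y) ≡ ιℤ (a * a′)
      scaled = begin
        ιℤ (d * d′) ℚ.* (x ℚ.* y)          ≡⟨ cong (ℚ._* (x ℚ.* y)) (ιℤ-* d d′) ⟩
        ιℤ d ℚ.* ιℤ d′ ℚ.* (x ℚ.* y)       ≡⟨ rearrange (ιℤ d) (ιℤ d′) x y ⟩
        ιℤ d ℚ.* x ℚ.* (ιℤ d′ ℚ.* y)       ≡⟨ cong₂ ℚ._*_ e e′ ⟩
        ιℤ a ℚ.* ιℤ a′                     ≡⟨ ιℤ-* a a′ ⟨
        ιℤ (a * a′)                        ∎

    modℚ-ι : ∀ z → ιℤ z ≃ z [modℚ m ]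
    modℚ-ι z = congruentℚ {denominator = 1ℤ} {z} inv-1 (ℚP.*-identityˡ (ιℤ z)) (≡⇒≡mod (sym (ℤP.*-identityˡ z)))

    modℚ-resp : ∀ {x z w} → z ≡ w [mod m ] → x ≃ z [modℚ m ] → x ≃ w [modℚ m ]
    modℚ-resp h (congruentℚ {d} i e c) = congruentℚ i e (mod-trans c (mod-*ˡ d h))

    modℚ-pow : ∀ {x z} k → x ≃ z [modℚ m ] → powℚ x k ≃ z ^ k [modℚ m ]
    modℚ-pow zero    h = modℚ-ι 1ℤ
    modℚ-pow (suc k) h = modℚ-* h (modℚ-pow k h)

    modℚ-sum : ∀ k {f g} → (∀ j → j ℕ.< suc k → f j ≃ g j [modℚ m ]) → sumTo k f ≃ ∑< (suc k) g [modℚ m ]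
    modℚ-sum zero    {f} {g} h = modℚ-resp (≡⇒≡mod (sym (ℤP.+-identityˡ (g 0)))) (h 0 (s≤s z≤n))
    modℚ-sum (suc k) h = modℚ-+ (modℚ-sum k λ j j<k → h j (ℕP.m<n⇒m<1+n j<k)) (h (suc k) ℕP.≤-refl)

  -- From d·y = a in ℚ follows d·↥y = a·↧y in ℤ; as m divides a, the unit d can be cancelled.
  ↥-mod : ∀ {m} y → y ≃ 0ℤ [modℚ m ] → ↥ y ≡ 0ℤ [mod m ]
  ↥-mod {m} y (congruentℚ {d} {a} i e c) = inv-cancel i (begin
    d * ↥ y            ≡⟨ ιℤ-scale d y a e ⟩
    a * ↧ y            ≈⟨ mod-*ʳ (↧ y) c ⟩
    d * 0ℤ * ↧ y       ≡⟨ cong (_* ↧ y) (ℤP.*-zeroʳ d) ⟩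
    0ℤ                 ≡⟨ ℤP.*-zeroʳ d ⟨
    d * 0ℤ             ∎)
    where open ModReasoning m

  modℚ⇒≡ℚ : ∀ {x z} m → x ≃ z [modℚ + m ] → x ≡ℚ z [mod m ]
  modℚ⇒≡ℚ {x} {z} m h = ≡0⇒∣ (↥-mod (x ℚ.- ιℤ z) (subst (λ y → x ℚ.+ y ≃ 0ℤ [modℚ + m ]) (ιℤ-neg z)
    (modℚ-resp (≡⇒≡mod (ℤP.+-inverseʳ z)) (modℚ-+ h (modℚ-ι (- z))))))

  modℚ-conclude : ∀ {x z w M} m → M ≡ + m → x ≃ z [modℚ M ] → z ≡ w [mod M ] → x ≡ℚ w [mod m ]
  modℚ-conclude m refl h e = modℚ⇒≡ℚ m (modℚ-resp e h)

  -- The hypergeometric side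

  factℚ≡ : ∀ k → factℚ k ≡ ιℤ (fact k)
  factℚ≡ zero    = refl
  factℚ≡ (suc k) = trans (cong (ℚ._* ι (suc k)) (factℚ≡ k)) (sym (ιℤ-* (fact k) (+ suc k)))

  ∏≢0 : ∀ k f → (∀ j → f j ≢ 0ℤ) → ∏< k f ≢ 0ℤ
  ∏≢0 zero    f h ()
  ∏≢0 (suc k) f h e with ℤP.i*j≡0⇒i≡0∨j≡0 (∏< k f) e
  ... | inj₁ e′ = ∏≢0 k f h e′
  ... | inj₂ e′ = h k e′

  ιℤ≢0 : ∀ {z} → z ≢ 0ℤ → ιℤ z ≢ 0ℚ
  ιℤ≢0 z≢0 e = z≢0 (ιℤ-injective e)

  factℚ≢0 : ∀ k → factℚ k ≢ 0ℚ
  factℚ≢0 k e = ιℤ≢0 (∏≢0 k (λ j → + suc j) λ j ()) (trans (sym (factℚ≡ k)) e)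

  -- The integer nᵏ (1 + 1/n)ₖ.
  D : ℕ → ℕ → ℤ
  D n k = ∏< k (λ j → + n * + suc j + 1ℤ)

  D≢0 : ∀ n k → D n k ≢ 0ℤ
  D≢0 n k = ∏≢0 k _ λ j e → positive (trans (sym (trans (cong (_+ 1ℤ) (sym (ℤP.pos-* n (suc j))))
      (ℤP.+-comm (+ (n ℕ.* suc j)) 1ℤ))) e)
    where
    positive : ∀ {j} → + suc j ≢ 0ℤ
    positive ()

  poch-D : ∀ d k → let n = suc d in poch (frac (suc n) n) k ℚ.* ιℤ ((+ n) ^ k) ≡ ιℤ (D n k)
  poch-D d zero    = refl
  poch-D d (suc k) = begin
    π ℚ.* (b ℚ.+ ι k) ℚ.* ιℤ (N * N ^ k)                 ≡⟨ cong (π ℚ.* (b ℚ.+ ι k) ℚ.*_) (ιℤ-* N (N ^ k)) ⟩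
    π ℚ.* (b ℚ.+ ι k) ℚ.* (ιℤ N ℚ.* ιℤ (N ^ k))          ≡⟨ rearrange π b (ι k) (ιℤ N) (ιℤ (N ^ k)) ⟩
    π ℚ.* ιℤ (N ^ k) ℚ.* (ιℤ N ℚ.* b ℚ.+ ιℤ N ℚ.* ι k)
      ≡⟨ cong₂ (λ x y → x ℚ.* y) (poch-D d k) (cong₂ ℚ._+_ (ιℤ-frac (suc (suc d)) d) (sym (ιℤ-* N (+ k)))) ⟩
    ιℤ (D (suc d) k) ℚ.* (ιℤ (1ℤ + N) ℚ.+ ιℤ (N * + k))  ≡⟨ cong (ιℤ (D (suc d) k) ℚ.*_) (sym (ιℤ-+ (1ℤ + N) (N * + k))) ⟩
    ιℤ (D (suc d) k) ℚ.* ιℤ (1ℤ + N + N * + k)           ≡⟨ cong (λ z → ιℤ (D (suc d) k) ℚ.* ιℤ z) (factor N (+ k)) ⟩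
    ιℤ (D (suc d) k) ℚ.* ιℤ (N * + suc k + 1ℤ)           ≡⟨ ιℤ-* (D (suc d) k) (N * + suc k + 1ℤ) ⟨
    ιℤ (D (suc d) (suc k))                               ∎
    where
    open ≡-Reasoning
    N = + suc d
    b = frac (suc (suc d)) (suc d)
    π = poch b k
    rearrange : ∀ π b k n m → π ℚ.* (b ℚ.+ k) ℚ.* (n ℚ.* m) ≡ π ℚ.* m ℚ.* (n ℚ.* b ℚ.+ n ℚ.* k)
    rearrange = solveℚ ℚ-ring
    factor : ∀ N k → 1ℤ + N + N * k ≡ N * (1ℤ + k) + 1ℤ
    factor = solve-∀

  poch≢0 : ∀ d k → poch (frac (suc (suc d)) (suc d)) k ≢ 0ℚ
  poch≢0 d k e = ιℤ≢0 (D≢0 (suc d) k) (trans (sym (poch-D d k))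
    (trans (cong (ℚ._* ιℤ ((+ suc d) ^ k)) e) (ℚP.*-zeroˡ (ιℤ ((+ suc d) ^ k)))))

  prodPoch-replicate : ∀ m x k → prodPoch (replicate m x) k ≡ powℚ (poch x k) m
  prodPoch-replicate zero    x k = refl
  prodPoch-replicate (suc m) x k = cong (poch x k ℚ.*_) (prodPoch-replicate m x k)

  poch-1 : ∀ k → poch (ι 1) k ≡ factℚ k
  poch-1 zero    = refl
  poch-1 (suc k) = cong₂ ℚ._*_ (poch-1 k) (sym (ιℤ-+ 1ℤ (+ k)))

  sumTo-*ˡ : ∀ c m f → c ℚ.* sumTo m f ≡ sumTo m (λ k → c ℚ.* f k)
  sumTo-*ˡ c zero    f = refl
  sumTo-*ˡ c (suc m) f = trans (ℚP.*-distribˡ-+ c (sumTo m f) (f (suc m))) (cong (ℚ._+ c ℚ.* f (suc m)) (sumTo-*ˡ c m f))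

  sumTo-cong : ∀ m {f g} → (∀ k → f k ≡ g k) → sumTo m f ≡ sumTo m g
  sumTo-cong zero    h = h 0
  sumTo-cong (suc m) h = cong₂ ℚ._+_ (sumTo-cong m h) (h (suc m))

  -- Of the n + 1 numerator factors k!, one cancels the k! of the series and the other n join the
  -- n-th power.
  truncHyp-sum : ∀ d x m → let n = suc d in
    powℚ x n ℚ.* truncHyp (replicate (suc n) (ι 1)) (replicate n (frac (suc n) n)) (ι 1) m
      ≡ sumTo m (λ k → powℚ ((x ℚ.* factℚ k) ÷' poch (frac (suc n) n) k) n)
  truncHyp-sum d x m = trans (sumTo-*ˡ (powℚ x n) m _) (sumTo-cong m term)
    where
    n = suc d
    b = frac (suc n) n
    open ≡-Reasoning
    rearrange : ∀ x f g y i → x ℚ.* (f ℚ.* g ℚ.* y ℚ.* (1ℚ ℚ.* i)) ≡ (x ℚ.* g) ℚ.* y ℚ.* (f ℚ.* i)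
    rearrange = solveℚ ℚ-ring
    term : ∀ k → powℚ x n ℚ.* ((prodPoch (replicate (suc n) (ι 1)) k ÷' prodPoch (replicate n b) k) ℚ.* (powℚ (ι 1) k ÷' factℚ k))
      ≡ powℚ ((x ℚ.* factℚ k) ÷' poch b k) n
    term k = begin
      powℚ x n ℚ.* ((prodPoch (replicate (suc n) (ι 1)) k ℚ.* inv (prodPoch (replicate n b) k)) ℚ.* (powℚ (ι 1) k ℚ.* inv f))
        ≡⟨ cong₂ (λ s t → powℚ x n ℚ.* (s ℚ.* (t ℚ.* inv f)))
             (cong₂ ℚ._*_ (trans (prodPoch-replicate (suc n) (ι 1) k) (cong (λ y → powℚ y (suc n)) (poch-1 k)))
               (trans (cong inv (prodPoch-replicate n b k)) (inv-unique {powℚ (poch b k) n} {powℚ (inv (poch b k)) n} (powℚ-inv (poch≢0 d k) n))))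
             (powℚ-1 k) ⟩
      powℚ x n ℚ.* (f ℚ.* powℚ f n ℚ.* powℚ (inv (poch b k)) n ℚ.* (1ℚ ℚ.* inv f))
        ≡⟨ rearrange (powℚ x n) f (powℚ f n) (powℚ (inv (poch b k)) n) (inv f) ⟩
      powℚ x n ℚ.* powℚ f n ℚ.* powℚ (inv (poch b k)) n ℚ.* (f ℚ.* inv f)
        ≡⟨ cong (powℚ x n ℚ.* powℚ f n ℚ.* powℚ (inv (poch b k)) n ℚ.*_) (inv-right {f} (factℚ≢0 k)) ⟩
      powℚ x n ℚ.* powℚ f n ℚ.* powℚ (inv (poch b k)) n ℚ.* 1ℚ
        ≡⟨ ℚP.*-identityʳ _ ⟩
      powℚ x n ℚ.* powℚ f n ℚ.* powℚ (inv (poch b k)) n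
        ≡⟨ cong (ℚ._* powℚ (inv (poch b k)) n) (powℚ-* x f n) ⟨
      powℚ (x ℚ.* f) n ℚ.* powℚ (inv (poch b k)) n
        ≡⟨ powℚ-* (x ℚ.* f) (inv (poch b k)) n ⟨
      powℚ ((x ℚ.* f) ÷' poch b k) n ∎
      where f = factℚ k

  -- Residues of the summands are available only below p, where the denominators are units; the
  -- default `a` fills the rest to give a total function.
  choose : ∀ {A : Set} {R : ℕ → A → Set} (a : A) m → (∀ k → k ℕ.< m → ∃ (R k)) →
    ∃ λ f → ∀ k → k ℕ.< m → R k (f k)
  choose {A} {R} a m h = f , spec
    where
    f : ℕ → A
    f k with k ℕP.<? m
    ... | yes k<m = proj₁ (h k k<m)
    ... | no _    = a
    spec : ∀ k → k ℕ.< m → R k (f k)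
    spec k k<m with k ℕP.<? m
    ... | yes k<m′ = proj₂ (h k k<m′)
    ... | no ¬k<m  = ⊥-elim (¬k<m k<m)

  scaled-residue : ∀ {x m d w} → Invertible m d → ιℤ d ℚ.* x ≡ ιℤ w →
    ∃ λ z → (d * z ≡ w [mod m ]) × (x ≃ z [modℚ m ])
  scaled-residue {d = d} {w} i@(invertible y e) scaled = y * w , solves , congruentℚ i scaled (mod-sym solves)
    where
    solves : d * (y * w) ≡ w [mod _ ]
    solves = mod-trans (≡⇒≡mod (sym (ℤP.*-assoc d y w))) (mod-trans (mod-*ʳ w e) (≡⇒≡mod (ℤP.*-identityˡ w)))

  -- Comparison of the two sides

  module Assembly (s : ℕ) (prime : Prime (4 ℕ.+ s)) (n₃ r : ℕ) (p₁≡rn : 3 ℕ.+ s ≡ r ℕ.* (3 ℕ.+ n₃)) where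
    open Gamma s prime n₃ r p₁≡rn public

    a : ℕ → ℚ
    a k = (ι p ℚ.* factℚ k) ÷' poch (frac (suc n) n) k

    -- The last factor of `D n r` is nr + 1 = p, and prepending the factor 1 at j = 0 turns the
    -- others into `u`.
    D-r : D n r ≡ P * u
    D-r = begin
      D n r                                           ≡⟨ ℤP.*-identityˡ (D n r) ⟨
      1ℤ * D n r
        ≡⟨ cong (_* D n r) (cong (_+ 1ℤ) (ℤP.*-zeroʳ N)) ⟨
      (N * + 0 + 1ℤ) * D n r                          ≡⟨ ∏.fold-head r (λ j → N * + j + 1ℤ) ⟨
      u * (N * + r + 1ℤ)                              ≡⟨ cong (u *_) Nr+1 ⟩
      u * P                                           ≡⟨ ℤP.*-comm u P ⟩
      P * u                                           ∎
      where open ≡-Reasoning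

    -- Both sides are `D n (k + r)`, split at k and at r.
    qD : ∀ k → q k * D n k ≡ P * u * E k
    qD k = begin
      q k * D n k
        ≡⟨ ℤP.*-comm (q k) (D n k) ⟩
      D n k * q k
        ≡⟨ cong (D n k *_) (∏.fold-cong r (λ i _ → shift N (+ k) (+ i))) ⟨
      D n k * ∏< r (λ i → N * + suc (k ℕ.+ i) + 1ℤ)
        ≡⟨ ∏.fold-++ k r (λ j → N * + suc j + 1ℤ) ⟨
      D n (k ℕ.+ r)
        ≡⟨ cong (D n) (ℕP.+-comm k r) ⟩
      D n (r ℕ.+ k)
        ≡⟨ ∏.fold-++ r k (λ j → N * + suc j + 1ℤ) ⟩
      D n r * ∏< k (λ i → N * + suc (r ℕ.+ i) + 1ℤ)
        ≡⟨ cong₂ _*_ D-r (∏.fold-cong k (λ i _ → trans (wrap N (+ r) (+ i)) (cong (λ z → N * + suc i + z) Nr+1))) ⟩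
      P * u * E k ∎
      where
      open ≡-Reasoning
      shift : ∀ N k i → N * (1ℤ + (k + i)) + 1ℤ ≡ N * k + (N * (1ℤ + i) + 1ℤ)
      shift = solve-∀
      wrap : ∀ N r i → N * (1ℤ + (r + i)) + 1ℤ ≡ N * (1ℤ + i) + (N * r + 1ℤ)
      wrap = solve-∀

    a-scaled : ∀ k → ιℤ (u * E k) ℚ.* a k ≡ ιℤ (q k * ∏< k (λ j → N * + suc j))
    a-scaled k = ℚ-cancel (ιℤ≢0 (D≢0 n k)) (begin
      ιℤ (u * E k) ℚ.* a k ℚ.* ιℤ (D n k)
        ≡⟨ cong (ιℤ (u * E k) ℚ.* a k ℚ.*_) (poch-D (2 ℕ.+ n₃) k) ⟨
      ιℤ (u * E k) ℚ.* (ι p ℚ.* factℚ k ℚ.* inv π) ℚ.* (π ℚ.* ιℤ (N ^ k))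
        ≡⟨ rearrange (ιℤ (u * E k)) (ι p) (factℚ k) (inv π) π (ιℤ (N ^ k)) ⟩
      ιℤ (u * E k) ℚ.* (ι p ℚ.* (factℚ k ℚ.* ιℤ (N ^ k))) ℚ.* (π ℚ.* inv π)
        ≡⟨ cong (ιℤ (u * E k) ℚ.* (ι p ℚ.* (factℚ k ℚ.* ιℤ (N ^ k))) ℚ.*_) (inv-right (poch≢0 (2 ℕ.+ n₃) k)) ⟩
      ιℤ (u * E k) ℚ.* (ι p ℚ.* (factℚ k ℚ.* ιℤ (N ^ k))) ℚ.* 1ℚ
        ≡⟨ ℚP.*-identityʳ _ ⟩
      ιℤ (u * E k) ℚ.* (ι p ℚ.* (factℚ k ℚ.* ιℤ (N ^ k)))
        ≡⟨ cong (λ z → ιℤ (u * E k) ℚ.* (ι p ℚ.* z))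
             (trans (cong (ℚ._* ιℤ (N ^ k)) (factℚ≡ k)) (sym (ιℤ-* (fact k) (N ^ k)))) ⟩
      ιℤ (u * E k) ℚ.* (ιℤ P ℚ.* ιℤ (fact k * N ^ k))
        ≡⟨ cong (ιℤ (u * E k) ℚ.*_) (ιℤ-* P (fact k * N ^ k)) ⟨
      ιℤ (u * E k) ℚ.* ιℤ (P * (fact k * N ^ k))
        ≡⟨ ιℤ-* (u * E k) (P * (fact k * N ^ k)) ⟨
      ιℤ (u * E k * (P * (fact k * N ^ k)))
        ≡⟨ cong ιℤ integers ⟩
      ιℤ (q k * F * D n k)
        ≡⟨ ιℤ-* (q k * F) (D n k) ⟩
      ιℤ (q k * F) ℚ.* ιℤ (D n k) ∎)
      where
      open ≡-Reasoning
      π = poch (frac (suc n) n) k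
      F = ∏< k (λ j → N * + suc j)
      rearrange : ∀ d p f i π m → d ℚ.* (p ℚ.* f ℚ.* i) ℚ.* (π ℚ.* m) ≡ d ℚ.* (p ℚ.* (f ℚ.* m)) ℚ.* (π ℚ.* i)
      rearrange = solveℚ ℚ-ring
      regroup : ∀ u e P f m → u * e * (P * (f * m)) ≡ P * u * e * (m * f)
      regroup = solve-∀
      swap : ∀ q d f → q * d * f ≡ q * f * d
      swap = solve-∀
      F≡ : F ≡ N ^ k * fact k
      F≡ = trans (∏.fold-∙ k (λ _ → N) (λ j → + suc j)) (cong (_* fact k) (∏-const N k))
      integers : u * E k * (P * (fact k * N ^ k)) ≡ q k * F * D n k
      integers = begin
        u * E k * (P * (fact k * N ^ k))   ≡⟨ regroup u (E k) P (fact k) (N ^ k) ⟩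
        P * u * E k * (N ^ k * fact k)     ≡⟨ cong₂ _*_ (qD k) F≡ ⟨
        q k * D n k * F                    ≡⟨ swap (q k) (D n k) F ⟩
        q k * F * D n k                    ∎

    -- One integer has to satisfy both relations: the first feeds `∑-expansion`, the second
    -- transfers the result to the rational sum.
    Residue : ℕ → ℤ → Set
    Residue k z = (u * E k * z ≡ q k * ∏< k (λ j → N * + suc j) [mod P³ ]) × (a k ≃ z [modℚ P³ ])

    a-residue : ∀ k → k ℕ.< p → ∃ (Residue k)
    a-residue k k<p = scaled-residue (denominator-invertible k k<p) (a-scaled k)

    congruence : ∀ X t → N * + X ≡ 1ℤ + + t * P³ →
      sumTo p₁ (λ k → powℚ (a k) n) ≡ℚ - powℤ (Γp-nat p X) n [mod p ℕ.^ 3 ]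
    congruence X t NX = modℚ-conclude {sumTo p₁ (λ k → powℚ (a k) n)} {∑< p (λ k → z k ^ n)} { - Γⁿ}
      (p ℕ.^ 3) (sym P³≡)
      (modℚ-sum p₁ {λ k → powℚ (a k) n} {λ k → z k ^ n} λ k k<p → modℚ-pow n (proj₂ (spec k k<p)))
      (inv-cancel (inv-^ n u-invertible) (begin
        u ^ n * ∑< p (λ k → z k ^ n)  ≈⟨ ∑-expansion z (λ k k<p → proj₁ (spec k k<p)) ⟩
        N^p₁ * fact p₁                ≡⟨ ℤP.neg-involutive (N^p₁ * fact p₁) ⟨
        - - (N^p₁ * fact p₁)          ≈⟨ mod-neg (Γ-power X t NX) ⟨
        - (u ^ n * Γⁿ)                ≡⟨ ℤP.neg-distribʳ-* (u ^ n) Γⁿ ⟩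
        u ^ n * - Γⁿ                  ∎))
      where
      open ModReasoning P³
      Γⁿ : ℤ
      Γⁿ = powℤ (Γp-nat p X) n
      chosen : ∃ λ (z : ℕ → ℤ) → ∀ k → k ℕ.< p → Residue k (z k)
      chosen = choose {ℤ} {Residue} 0ℤ p a-residue
      z : ℕ → ℤ
      z = proj₁ chosen
      spec : ∀ k → k ℕ.< p → Residue k (z k)
      spec = proj₂ chosen

    supercongruence : ∀ X → 1 ℕ.≤ X → p ℕ.^ 3 ∣ n ℕ.* X ℕ.∸ 1 →
      sumTo p₁ (λ k → powℚ (a k) n) ≡ℚ - powℤ (Γp-nat p X) n [mod p ℕ.^ 3 ]
    supercongruence X 1≤X (divides t e) = congruence X t (begin
      N * + X                        ≡⟨ ℤP.pos-* n X ⟨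
      -- X ≥ 1 makes nX ≥ 1, so the truncated subtraction is a true one.
      + (n ℕ.* X)                    ≡⟨ cong +_ (ℕP.m+[n∸m]≡n (ℕP.*-mono-≤ {1} {n} (s≤s z≤n) 1≤X)) ⟨
      1ℤ + + (n ℕ.* X ℕ.∸ 1)         ≡⟨ cong (λ z → 1ℤ + + z) e ⟩
      1ℤ + + (t ℕ.* p ℕ.^ 3)         ≡⟨ cong (λ z → 1ℤ + z) (trans (ℤP.pos-* t (p ℕ.^ 3)) (cong (+ t *_) P³≡)) ⟩
      1ℤ + + t * P³                  ∎)
      where open ≡-Reasoning

open import Data.Nat using (ℕ; suc; _≤_; _*_; _∸_; _^_)

theorem1p2 : (n p : ℕ) → 3 ≤ n → Prime p → n ∣ p ∸ 1 →
    (powℚ (ι p) n ℚ.* truncHyp (replicate (suc n) (ι 1)) (replicate n (frac (suc n) n)) (ι 1) (p ∸ 1)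
    ≡ sumTo (p ∸ 1) (λ k → powℚ ((ι p ℚ.* factℚ k) ÷' poch (frac (suc n) n) k) n))
    × ∃ λ K → (N : ℕ) → 1 ≤ N → p ^ K ∣ (n * N ∸ 1) →
    sumTo (p ∸ 1) (λ k → powℚ ((ι p ℚ.* factℚ k) ÷' poch (frac (suc n) n) k) n)
    ≡ℚ ℤ.- powℤ (Γp-nat p N) n [mod p ^ 3 ]
theorem1p2 n 0 _ p-prime _ = ⊥-elim (¬prime[0] p-prime)
theorem1p2 n 1 _ p-prime _ = ⊥-elim (¬prime[1] p-prime)
-- A divisor n ≥ 3 of p - 1 forces p ≥ 4, which excludes p = 2 here and p = 3 in the next case.
theorem1p2 n 2 3≤n _ n∣1 with ℕP.≤-trans 3≤n (ℕD.∣⇒≤ n∣1)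
... | s≤s ()
theorem1p2 n 3 3≤n _ n∣2 with ℕP.≤-trans 3≤n (ℕD.∣⇒≤ n∣2)
... | s≤s (s≤s ())
theorem1p2 (suc (suc (suc n₃))) (suc (suc (suc (suc s)))) (s≤s (s≤s (s≤s z≤n))) p-prime (divides r p₁≡rn) =
  Lemmas.truncHyp-sum (suc (suc n₃)) (ι (suc (suc (suc (suc s))))) (suc (suc (suc s))) ,
  -- K = 3 suffices because nN ≡ 1 is used only modulo p³.
  3 , Lemmas.Assembly.supercongruence s p-prime n₃ r p₁≡rn
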